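{- INDEPENDENT CUTSET can be solved in $\mathcal{O}^*(3^k)$ time, where $k$ is the odd cycle transversal number of the input graph $G$.
   Context: All graphs are finite, simple, loopless and undirected. A set $S$ of vertices of a graph $G$ is a cutset of $G$ if $G-S$ is disconnected; it is an independent set if its vertices are pairwise nonadjacent. An independent cutset of $G$ is a set of vertices that is both a cutset and an independent set of $G$. INDEPENDENT CUTSET is the decision problem: given a connected graph $G$, does $G$ have an independent cutset? An odd cycle transversal of $G$ is a set of vertices $X$ such that $G-X$ is bipartite; the odd cycle transversal number of $G$ is the minimum cardinality of such a set. The notation $\mathcal{O}^*$ is the $\mathcal{O}$-notation with factors polynomial in the input size suppressed. -}

module Defs where

open import Data.Bool using (Bool; true; false)
open import Data.Fin using (Fin)
open import Data.Fin.Subset using (Subset; _∈_; _∉_; ∣_∣)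
open import Data.List using (List; []; _∷_; tabulate)
open import Data.Nat using (ℕ; suc; _+_; _≤_)
open import Data.Product using (∃; _×_; proj₁)
open import Function using (_∘_; _on_)
open import Level using (0ℓ)
open import Relation.Binary using (Rel; Decidable; Symmetric; Irreflexive)
open import Relation.Binary.Construct.Closure.ReflexiveTransitive using (Star)
open import Relation.Binary.PropositionalEquality using (_≡_; _≢_; cong)
open import Relation.Nullary using (¬_; does)

-- Simple loopless undirected graphs. Finite graphs are those of type
-- Graph (Fin n); the vertex type is a parameter so that G − S is again a
-- graph.
record Graph (V : Set) : Set₁ where
  infix 4 _~_ _~?_
  field
    _~_    : Rel V 0ℓ
    _~?_   : Decidable _~_
    sym    : Symmetric _~_
    irrefl : Irreflexive _≡_ _~_

infixl 6 _−_

_−_ : ∀ {n} → Graph (Fin n) → (S : Subset n) → Graph (∃ λ v → v ∉ S)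
G − S = record
  { _~_    = _~_ on proj₁
  ; _~?_   = λ u v → proj₁ u ~? proj₁ v
  ; sym    = sym
  ; irrefl = irrefl ∘ cong proj₁
  }
  where open Graph G

-- The graph without vertices counts as connected, so the whole vertex set
-- is never a cutset.
Connected : ∀ {V} → Graph V → Set
Connected G = ∀ u v → Star (Graph._~_ G) u v

Bipartite : ∀ {V} → Graph V → Set
Bipartite {V} G = ∃ λ (side : V → Bool) → ∀ {u v} → u ~ v → side u ≢ side v
  where open Graph G

module _ {n : ℕ} (G : Graph (Fin n)) where
  open Graph G

  Cutset : Subset n → Set
  Cutset S = ¬ Connected (G − S)

  Independent : Subset n → Set
  Independent S = ∀ {u v} → u ∈ S → v ∈ S → ¬ (u ~ v)

  HasIndependentCutset : Set
  HasIndependentCutset = ∃ λ S → Cutset S × Independent S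

  OddCycleTransversal : Subset n → Set
  OddCycleTransversal X = Bipartite (G − X)

  OddCycleTransversalNumber : ℕ → Set
  OddCycleTransversalNumber k =
    (∃ λ X → OddCycleTransversal X × ∣ X ∣ ≡ k) ×
    (∀ X → OddCycleTransversal X → k ≤ ∣ X ∣)

-- Jones's WHILE language over binary trees ("Computability and Complexity
-- from a Programming Perspective"), in its one-variable form: a program
-- maps the current value of the variable to a new one. Trees are immutable
-- and may be shared, and the only test is for nil, so each unit of time is
-- O(1) pointer operations on a RAM. Conversely, storing memory in a balanced
-- tree simulates T steps of a RAM with a slowdown polynomial in log T and the
-- input size, so running times of the form O*(3^k) do not depend on which of
-- the two models is used.

infixr 5 _∙_

data Tree : Set where
  nil : Tree
  _∙_ : Tree → Tree → Tree

size : Tree → ℕ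
size nil     = 1
size (l ∙ r) = suc (size l + size r)

head : Tree → Tree
head nil     = nil
head (l ∙ _) = l

tail : Tree → Tree
tail nil     = nil
tail (_ ∙ r) = r

infixr 4 _⨾_

data Prog : Set where
  var           : Prog
  const         : Tree → Prog
  hd tl         : Prog
  cons          : Prog → Prog → Prog
  _⨾_           : Prog → Prog → Prog
  if_then_else_ : Prog → Prog → Prog → Prog
  while_loop_     : Prog → Prog → Prog

infix 3 _⊢_⇓_⟨_⟩

-- p ⊢ x ⇓ y ⟨ t ⟩: on input x, the program p halts with output y after
-- exactly t steps.
data _⊢_⇓_⟨_⟩ : Prog → Tree → Tree → ℕ → Set where
  var : ∀ {x} →
    var ⊢ x ⇓ x ⟨ 1 ⟩
  const : ∀ {x d} →
    const d ⊢ x ⇓ d ⟨ 1 ⟩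
  hd : ∀ {x} →
    hd ⊢ x ⇓ head x ⟨ 1 ⟩
  tl : ∀ {x} →
    tl ⊢ x ⇓ tail x ⟨ 1 ⟩
  cons : ∀ {p q x y z s t} →
    p ⊢ x ⇓ y ⟨ s ⟩ →
    q ⊢ x ⇓ z ⟨ t ⟩ →
    cons p q ⊢ x ⇓ y ∙ z ⟨ suc (s + t) ⟩
  _⨾_ : ∀ {p q x y z s t} →
    p ⊢ x ⇓ y ⟨ s ⟩ →
    q ⊢ y ⇓ z ⟨ t ⟩ →
    p ⨾ q ⊢ x ⇓ z ⟨ suc (s + t) ⟩
  if-true : ∀ {b p q x l r y s t} →
    b ⊢ x ⇓ l ∙ r ⟨ s ⟩ →
    p ⊢ x ⇓ y ⟨ t ⟩ →
    if b then p else q ⊢ x ⇓ y ⟨ suc (s + t) ⟩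
  if-false : ∀ {b p q x y s t} →
    b ⊢ x ⇓ nil ⟨ s ⟩ →
    q ⊢ x ⇓ y ⟨ t ⟩ →
    if b then p else q ⊢ x ⇓ y ⟨ suc (s + t) ⟩
  while-true : ∀ {b p x l r y z s t u} →
    b ⊢ x ⇓ l ∙ r ⟨ s ⟩ →
    p ⊢ x ⇓ y ⟨ t ⟩ →
    while b loop p ⊢ y ⇓ z ⟨ u ⟩ →
    while b loop p ⊢ x ⇓ z ⟨ suc (s + t + u) ⟩
  while-false : ∀ {b p x s} →
    b ⊢ x ⇓ nil ⟨ s ⟩ →
    while b loop p ⊢ x ⇓ x ⟨ suc s ⟩

encodeBool : Bool → Tree
encodeBool false = nil
encodeBool true  = nil ∙ nil

encodeList : List Tree → Tree
encodeList []       = nil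
encodeList (x ∷ xs) = x ∙ encodeList xs

-- The adjacency matrix, as a list of rows.
encodeGraph : ∀ {n} → Graph (Fin n) → Tree
encodeGraph G =
  encodeList (tabulate λ u → encodeList (tabulate λ v → encodeBool (does (u ~? v))))
  where open Graph G

{-# OPTIONS --safe #-}
-- A vertex v that lies in no triangle has an independent neighbourhood, which
-- is a cutset unless G is a star with centre v; so on at least three vertices
-- such a vertex makes the answer yes. Otherwise an odd cycle transversal X of
-- size k meets every triangle, and all vertices lie in triangles. Branching
-- three ways on a triangle with a vertex not yet dominated finds, at depth at
-- most k and without knowing X, a dominating set D. Each of the 3 ^ |D|
-- labellings of D by left side, right side and cutset leaves at most two
-- labels for every other vertex, and whether one of them extends to a
-- labelling of G with both sides nonempty is a 2-SAT problem.

module Submission where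

open import Data.Bool as Bool using (Bool; true; false; _∧_; _∨_; not; T; T?)
open import Data.Bool.Properties using (T-∧; T-∨; T-≡; not-involutive; not-¬; ¬-not)
open import Data.Empty using (⊥; ⊥-elim)
open import Data.Fin as Fin using (Fin; zero; suc; toℕ; fromℕ; fromℕ<; inject₁)
open import Data.Fin.Properties as Fin using (any?; toℕ-injective; toℕ-inject₁; toℕ-fromℕ; toℕ<n)
open import Data.Fin.Relation.Unary.Top using (view; ‵fromℕ; ‵inject₁)
open import Data.Fin.Subset using (Subset; _∉_; _-_; ∣_∣; ⊤) renaming (_∈_ to _∈ₛ_)
open import Data.Fin.Subset.Properties using (_∈?_; x∈p∧x≢y⇒x∈p-y; x∈p⇒∣p-x∣<∣p∣; ∈⊤; ∣⊤∣≡n)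
open import Data.List as List
  using (List; []; _∷_; length; map; tabulate; foldl; _++_; replicate; allFin; cartesianProduct)
open import Data.List.Membership.Propositional using (_∈_; lose)
open import Data.List.Membership.Propositional.Properties using (∈-map⁺; ∈-cartesianProduct⁺)
open import Data.List.Properties
  using (foldl-++; foldl-map; foldl-cong; map-∘; map-cong; map-tabulate; ++-identityʳ;
         length-map; length-replicate; length-tabulate)
open import Data.List.Relation.Unary.All as All using (All; []; _∷_)
open import Data.List.Relation.Unary.Any as Any using (Any; here; there)
open import Data.Nat hiding (_!)
open import Data.Nat.Properties
open import Data.Nat.Tactic.RingSolver using (solve-∀)
open import Data.Product using (∃; ∃-syntax; _×_; _,_; proj₁; proj₂)
open import Data.Product.Properties using (≡-dec)
open import Data.Sum using (_⊎_; inj₁; inj₂; [_,_]′)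
open import Data.Unit using (tt)
open import Data.Vec as Vec using ()
open import Data.Vec.Properties using (lookup∘tabulate; []=⇒lookup; lookup⇒[]=)
open import Function using (_∘_; id; case_of_; _⇔_; mk⇔; Equivalence)
open import Level using (0ℓ)
open import Relation.Binary using (Rel; Decidable; Reflexive; Transitive)
open import Relation.Binary.Construct.Closure.ReflexiveTransitive using (Star; ε; _◅_; _◅◅_)
open import Relation.Binary.PropositionalEquality
open import Relation.Nullary
  using (¬_; Dec; yes; no; does; contradiction; ¬?; _×-dec_; _⊎-dec_; ¬¬-excluded-middle; Reflects; ofʸ; ofⁿ)
open import Relation.Nullary.Decidable using (True; toWitness)
open import Relation.Unary as Pred using (Pred)
open import Defs

open Equivalence using (to; from)

-- Two obstacles shape the proof. The number k is not part of the input, so the levels j = 0, 1, 2,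
-- ... are tried in turn: level j asks whether one of the `3 ^ j` corner strings of length j leads
-- to a dominating set. A minimum transversal guarantees success at level k, so the loop stops there
-- or earlier, and X occurs only in the analysis. Guessing corners and labels together would cost
-- `9 ^ j`; instead a level keeps a single dominating corner string, and the `3 ^ j` label strings
-- are tried along that one only, after the loop has stopped. Moreover, steps of concrete programs
-- have to be counted. Everything polynomial is therefore written in a small typed language that is
-- compiled together with its cost. Only the folds over the strings, the loop over the levels and
-- the setup of the input are programs written by hand.

infix 3 _⊢_⇓_within_

_⊢_⇓_within_ : Prog → Tree → Tree → ℕ → Set
p ⊢ x ⇓ y within t = ∃[ s ] (p ⊢ x ⇓ y ⟨ s ⟩) × s ≤ t

weaken : ∀ {p x y s t} → s ≤ t → p ⊢ x ⇓ y within s → p ⊢ x ⇓ y within t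
weaken s≤t (_ , r , ≤s) = _ , r , ≤-trans ≤s s≤t

var-within : ∀ {x} → var ⊢ x ⇓ x within 1
var-within = _ , var , ≤-refl

const-within : ∀ {x d} → const d ⊢ x ⇓ d within 1
const-within = _ , const , ≤-refl

hd-within : ∀ {l r} → hd ⊢ l ∙ r ⇓ l within 1
hd-within = _ , hd , ≤-refl

tl-within : ∀ {l r} → tl ⊢ l ∙ r ⇓ r within 1
tl-within = _ , tl , ≤-refl

cons-within : ∀ {p q x y z s t} → p ⊢ x ⇓ y within s → q ⊢ x ⇓ z within t →
  cons p q ⊢ x ⇓ y ∙ z within suc (s + t)
cons-within (_ , r , ≤s) (_ , r′ , ≤t) = _ , cons r r′ , s≤s (+-mono-≤ ≤s ≤t)

infixr 4 _⨾-within_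

_⨾-within_ : ∀ {p q x y z s t} → p ⊢ x ⇓ y within s → q ⊢ y ⇓ z within t →
  p ⨾ q ⊢ x ⇓ z within suc (s + t)
(_ , r , ≤s) ⨾-within (_ , r′ , ≤t) = _ , (r ⨾ r′) , s≤s (+-mono-≤ ≤s ≤t)

-- The bound charges for both branches, with `u` paying for the one not taken. It is thus the same
-- for either outcome of the test and has the shape of `⊕`.
if-true-within : ∀ {b p q x l r y s t} u → b ⊢ x ⇓ l ∙ r within s → p ⊢ x ⇓ y within t →
  if b then p else q ⊢ x ⇓ y within suc (s + suc (t + u))
if-true-within u (_ , r , ≤s) (_ , r′ , ≤t) =
  _ , if-true r r′ , s≤s (+-mono-≤ ≤s (≤-trans ≤t (m≤n⇒m≤1+n (m≤m+n _ u))))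

if-false-within : ∀ {b p q x y s t} u → b ⊢ x ⇓ nil within s → q ⊢ x ⇓ y within t →
  if b then p else q ⊢ x ⇓ y within suc (s + suc (u + t))
if-false-within u (_ , r , ≤s) (_ , r′ , ≤t) =
  _ , if-false r r′ , s≤s (+-mono-≤ ≤s (≤-trans ≤t (m≤n⇒m≤1+n (m≤n+m _ u))))

-- Folds over encoded lists

-- The body sees the tree element ∙ (accumulator ∙ x).
fold-loop : Prog → Prog
fold-loop b = while hd loop cons (hd ⨾ tl) (cons (cons (hd ⨾ hd) tl ⨾ b) (tl ⨾ tl))

fold : Prog → Prog → Prog → Prog
fold l i b = cons l (cons i var) ⨾ fold-loop b ⨾ tl ⨾ hd

module _ {A B : Set} (encA : A → Tree) (encB : B → Tree) (f : B → A → B) {b : Prog} {x : Tree} {c : ℕ}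
  (step : ∀ y a → b ⊢ encA y ∙ (encB a ∙ x) ⇓ encB (f a y) within c) where

  fold-loop-within : ∀ ys a →
    fold-loop b ⊢ encodeList (map encA ys) ∙ (encB a ∙ x) ⇓ nil ∙ (encB (foldl f a ys) ∙ x)
      within length ys * (16 + c) + 2
  fold-loop-within [] a = _ , while-false hd , ≤-refl
  fold-loop-within (y ∷ ys) a =
    let (_ , s , ≤s) = cons-within (hd-within ⨾-within tl-within)
                         (cons-within (cons-within (hd-within ⨾-within hd-within) tl-within ⨾-within step y a)
                           (tl-within ⨾-within tl-within))
        (_ , r , ≤r) = fold-loop-within ys (f a y)
    in _ , while-true hd s r , ≤-trans (s≤s (s≤s (+-mono-≤ ≤s ≤r))) (≤-reflexive (time c (length ys)))
    where
    time : ∀ c l → suc (suc (suc (3 + suc (suc (5 + c) + 3)) + (l * (16 + c) + 2))) ≡ (16 + c) + l * (16 + c) + 2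
    time = solve-∀

  fold-within : ∀ {l i s t} ys a →
    l ⊢ x ⇓ encodeList (map encA ys) within s → i ⊢ x ⇓ encB a within t →
    fold l i b ⊢ x ⇓ encB (foldl f a ys) within suc (suc (s + suc (t + 1)) + suc ((length ys * (16 + c) + 2) + 3))
  fold-within ys a l i =
    cons-within l (cons-within i var-within) ⨾-within fold-loop-within ys a ⨾-within tl-within ⨾-within hd-within

-- Polynomial cost expressions

-- Time bounds as functions of the number n of vertices. The constants in each
-- are the overhead of fold-loop per iteration and at its end.

infixl 6 _⊕_

data Cost : Set where
  one  : Cost
  _⊕_  : Cost → Cost → Cost
  each : Cost → Cost

_at_ : Cost → ℕ → ℕ
one     at n = 1
(a ⊕ b) at n = suc (a at n + b at n)
each c  at n = n * (16 + c at n) + 2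

-- Here `s` stands for the input size. Being positive, it has powers at least 1, which absorb all
-- constants. Adding the degrees under `⊕` lets both summands be raised to a common power.
at-polynomial : ∀ c → ∃[ k ] ∃[ d ] ∀ n s → n < s → c at n ≤ k * s ^ d
at-polynomial one = 1 , 0 , λ n s n<s → ≤-refl
at-polynomial (a ⊕ b) =
  let (k , d , pa) = at-polynomial a ; (l , e , pb) = at-polynomial b
  in suc (k + l) , d + e , λ { n s@(suc _) n<s →
    let open ≤-Reasoning in begin
      suc (a at n + b at n)                            ≤⟨ s≤s (+-mono-≤ (pa n s n<s) (pb n s n<s)) ⟩
      1 + (k * s ^ d + l * s ^ e)
        ≤⟨ +-mono-≤ (m^n>0 s (d + e)) (+-mono-≤
             (*-monoʳ-≤ k (^-monoʳ-≤ s (m≤m+n d e))) (*-monoʳ-≤ l (^-monoʳ-≤ s (m≤n+m e d)))) ⟩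
      s ^ (d + e) + (k * s ^ (d + e) + l * s ^ (d + e)) ≡⟨ cong (s ^ (d + e) +_) (*-distribʳ-+ (s ^ (d + e)) k l) ⟨
      suc (k + l) * s ^ (d + e)                        ∎ }
at-polynomial (each c) =
  let (k , d , pc) = at-polynomial c
  -- 18 is the 16 per iteration plus the 2 at the end of the loop.
  in 18 + k , suc d , λ { n s@(suc _) n<s →
    let open ≤-Reasoning
        1≤ : ∀ e → 1 ≤ s ^ e
        1≤ e = m^n>0 s e
    in begin
      n * (16 + c at n) + 2
        ≤⟨ +-mono-≤ (*-mono-≤ (<⇒≤ n<s) (+-mono-≤ (*-monoʳ-≤ 16 (1≤ d)) (pc n s n<s))) (*-monoʳ-≤ 2 (1≤ (suc d))) ⟩
      s * (16 * s ^ d + k * s ^ d) + 2 * (s * s ^ d) ≡⟨ collect s (s ^ d) k ⟩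
      (18 + k) * (s * s ^ d)                         ∎ }
  where
  collect : ∀ s m k → s * (16 * m + k * m) + 2 * (s * m) ≡ (18 + k) * (s * m)
  collect = solve-∀

-- A language with polynomial running times

-- A typed language in which the only iteration is over the vertices of the
-- graph, so that the running time is polynomial in n by construction.

data Label : Set where
  left right cut : Label

choose : {A : Set} → Label → A → A → A → A
choose left  a b c = a
choose right a b c = b
choose cut   a b c = c

uncons : {A B : Set} → List A → B → (A → List A → B) → B
uncons []       b f = b
uncons (x ∷ xs) b f = f x xs

-- The vertices in decreasing order, so that consing yields increasing order.
down : ∀ n → List (Fin n)
down zero    = []
down (suc n) = fromℕ n ∷ map inject₁ (down n)

infixr 7 _⊗_

data Ty : Set where
  bool label vertex     : Ty
  _⊗_                   : Ty → Ty → Ty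
  list duo array        : Ty → Ty

⟦_⟧ : Ty → ℕ → Set
⟦ bool ⟧    n = Bool
⟦ label ⟧   n = Label
⟦ vertex ⟧  n = Fin n
⟦ S ⊗ T ⟧   n = ⟦ S ⟧ n × ⟦ T ⟧ n
⟦ list T ⟧  n = List (⟦ T ⟧ n)
⟦ duo T ⟧   n = Bool → ⟦ T ⟧ n
⟦ array T ⟧ n = Fin n → ⟦ T ⟧ n

-- The numeral n is the list of its predecessors in decreasing order: it
-- serves both as a vertex and as a list to iterate over.
numeral : ℕ → Tree
numeral zero    = nil
numeral (suc n) = numeral n ∙ numeral n

-- Two tests for nil tell the labels apart: one of the tree, one of its tail.
encodeLabel : Label → Tree
encodeLabel left  = nil
encodeLabel right = nil ∙ nil
encodeLabel cut   = nil ∙ (nil ∙ nil)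

encode : ∀ {n} T → ⟦ T ⟧ n → Tree
encode bool      b       = encodeBool b
encode label     l       = encodeLabel l
encode vertex    i       = numeral (toℕ i)
encode (S ⊗ T)   (x , y) = encode S x ∙ encode T y
encode (list T)  xs      = encodeList (map (encode T) xs)
encode (duo T)   f       = encode T (f false) ∙ encode T (f true)
encode (array T) f       = encodeList (tabulate λ i → encode T (f i))

Ctx : Set
Ctx = List Ty

Env : ℕ → Ctx → Set
Env n = All (λ T → ⟦ T ⟧ n)

-- The numeral n lies beneath all variables, so every term can reach the list of vertices.
encodeEnv : ∀ {n Γ} → Env n Γ → Tree
encodeEnv {n} []          = numeral n
encodeEnv (_∷_ {x = T} v ρ) = encode T v ∙ encodeEnv ρ

lookupEnv : ∀ {n Γ} → Env n Γ → (i : Fin (length Γ)) → ⟦ List.lookup Γ i ⟧ n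
lookupEnv (v ∷ ρ) zero    = v
lookupEnv (v ∷ ρ) (suc i) = lookupEnv ρ i

infixl 9 _!_ _!!_
infix  8 _<ᵗ_
infixr 7 _and_
infixr 6 _or_
infixr 5 _,ᵗ_

data Term (Γ : Ctx) : Ty → Set

data Args (Γ : Ctx) : Ctx → Set where
  []  : Args Γ []
  _∷_ : ∀ {T Δ} → Term Γ T → Args Γ Δ → Args Γ (T ∷ Δ)

data Term Γ where
  var      : (i : Fin (length Γ)) → Term Γ (List.lookup Γ i)
  bit      : Bool → Term Γ bool
  _and_    : Term Γ bool → Term Γ bool → Term Γ bool
  _or_     : Term Γ bool → Term Γ bool → Term Γ bool
  neg      : Term Γ bool → Term Γ bool
  cond     : ∀ {T} → Term Γ bool → Term Γ T → Term Γ T → Term Γ T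
  lab      : Label → Term Γ label
  switch   : ∀ {T} → Term Γ label → Term Γ T → Term Γ T → Term Γ T → Term Γ T
  empty    : ∀ {T} → Term Γ (list T)
  push     : ∀ {T} → Term Γ T → Term Γ (list T) → Term Γ (list T)
  match    : ∀ {S T} → Term Γ (list S) → Term Γ T → Term (S ∷ list S ∷ Γ) T → Term Γ T
  _,ᵗ_     : ∀ {S T} → Term Γ S → Term Γ T → Term Γ (S ⊗ T)
  fst      : ∀ {S T} → Term Γ (S ⊗ T) → Term Γ S
  snd      : ∀ {S T} → Term Γ (S ⊗ T) → Term Γ T
  both     : ∀ {T} → Term (bool ∷ Γ) T → Term Γ (duo T)
  _!!_     : ∀ {T} → Term Γ (duo T) → Term Γ bool → Term Γ T
  tab      : ∀ {T} → Term (vertex ∷ Γ) T → Term Γ (array T)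
  _!_      : ∀ {T} → Term Γ (array T) → Term Γ vertex → Term Γ T
  _<ᵗ_     : Term Γ vertex → Term Γ vertex → Term Γ bool
  for      : ∀ {T} → Term Γ T → Term (vertex ∷ T ∷ Γ) T → Term Γ T
  -- A fresh environment for the callee makes terms reusable without weakening or substitution.
  call     : ∀ {Δ T} → Term Δ T → Args Γ Δ → Term Γ T

#_ : ∀ {Γ} k {k< : True (k <? length Γ)} → Term Γ (List.lookup Γ (fromℕ< (toWitness k<)))
#_ k {k<} = var (fromℕ< (toWitness k<))

eval     : ∀ {Γ T n} → Term Γ T → Env n Γ → ⟦ T ⟧ n
evalArgs : ∀ {Γ Δ n} → Args Γ Δ → Env n Γ → Env n Δ

eval (var i)          ρ = lookupEnv ρ i
eval (bit b)          ρ = b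
eval (a and b)        ρ = eval a ρ ∧ eval b ρ
eval (a or b)         ρ = eval a ρ ∨ eval b ρ
eval (neg a)          ρ = not (eval a ρ)
eval (cond c t e)     ρ = Bool.if eval c ρ then eval t ρ else eval e ρ
eval (lab l)          ρ = l
eval (switch l a b c) ρ = choose (eval l ρ) (eval a ρ) (eval b ρ) (eval c ρ)
eval empty            ρ = []
eval (push x xs)      ρ = eval x ρ ∷ eval xs ρ
eval (match xs e c)   ρ = uncons (eval xs ρ) (eval e ρ) (λ y ys → eval c (y ∷ ys ∷ ρ))
eval (s ,ᵗ t)         ρ = eval s ρ , eval t ρ
eval (fst t)          ρ = proj₁ (eval t ρ)
eval (snd t)          ρ = proj₂ (eval t ρ)
eval (both t)         ρ = λ b → eval t (b ∷ ρ)
eval (f !! b)         ρ = eval f ρ (eval b ρ)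
eval (tab t)          ρ = λ i → eval t (i ∷ ρ)
eval (f ! i)          ρ = eval f ρ (eval i ρ)
eval (i <ᵗ j)         ρ = toℕ (eval i ρ) <ᵇ toℕ (eval j ρ)
eval {n = n} (for a t) ρ = foldl (λ acc i → eval t (i ∷ acc ∷ ρ)) (eval a ρ) (down n)
eval (call t as)      ρ = eval t (evalArgs as ρ)

evalArgs []       ρ = []
evalArgs (t ∷ as) ρ = eval t ρ ∷ evalArgs as ρ

-- Compilation and its cost

get : ℕ → Prog
get zero    = hd
get (suc k) = tl ⨾ get k

vertices : Ctx → Prog
vertices []      = var
vertices (_ ∷ Γ) = tl ⨾ vertices Γ

compile     : ∀ {Γ T} → Term Γ T → Prog
compileArgs : ∀ {Γ Δ} → Args Γ Δ → Prog

compile (var i)          = get (toℕ i)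
compile (bit b)          = const (encodeBool b)
compile (a and b)        = if compile a then compile b else const nil
compile (a or b)         = if compile a then const (nil ∙ nil) else compile b
compile (neg a)          = if compile a then const nil else const (nil ∙ nil)
compile (cond c t e)     = if compile c then compile t else compile e
compile (lab l)          = const (encodeLabel l)
compile (switch l a b c) =
  if compile l then (if compile l ⨾ tl then compile c else compile b) else compile a
compile empty            = const nil
compile (push x xs)      = cons (compile x) (compile xs)
compile (match xs e c)   =
  if compile xs then cons (compile xs ⨾ hd) (cons (compile xs ⨾ tl) var) ⨾ compile c else compile e
compile (s ,ᵗ t)         = cons (compile s) (compile t)
compile (fst t)          = compile t ⨾ hd
compile (snd t)          = compile t ⨾ tl
compile (both t)         =
  cons (cons (const (encodeBool false)) var ⨾ compile t) (cons (const (encodeBool true)) var ⨾ compile t)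
compile (f !! b)         = if compile b then (compile f ⨾ tl) else (compile f ⨾ hd)
compile {Γ} (tab t)      =
  fold (vertices Γ) (const nil) (cons (cons hd (tl ⨾ tl) ⨾ compile t) (tl ⨾ hd))
-- As a list, the numeral of `i` has i elements, so folding over it takes i tails. The same fold on
-- the numeral of `j` leaves a nonempty tree exactly when i < j.
compile (f ! i)          = fold (compile i) (compile f) (tl ⨾ hd ⨾ tl) ⨾ hd
compile (i <ᵗ j)         =
  if fold (compile i) (compile j) (tl ⨾ hd ⨾ tl) then const (nil ∙ nil) else const nil
-- A fold hands its body the element, the accumulator and the rest, which is already the environment
-- of `t`.
compile {Γ} (for a t)    = fold (vertices Γ) (compile a) (compile t)
compile (call t as)      = compileArgs as ⨾ compile t

-- The callee needs the list of vertices below its arguments.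
compileArgs {Γ} []   = vertices Γ
compileArgs (t ∷ as) = cons (compile t) (compileArgs as)

getCost : ℕ → Cost
getCost zero    = one
getCost (suc k) = one ⊕ getCost k

verticesCost : Ctx → Cost
verticesCost []      = one
verticesCost (_ ∷ Γ) = one ⊕ verticesCost Γ

foldCost : Cost → Cost → Cost → Cost
foldCost l i b = l ⊕ (i ⊕ one) ⊕ (each b ⊕ (one ⊕ one))

tailCost : Cost
tailCost = one ⊕ (one ⊕ one)

cost     : ∀ {Γ T} → Term Γ T → Cost
costArgs : ∀ {Γ Δ} → Args Γ Δ → Cost

cost (var i)          = getCost (toℕ i)
cost (bit b)          = one
cost (a and b)        = cost a ⊕ (cost b ⊕ one)
cost (a or b)         = cost a ⊕ (one ⊕ cost b)
cost (neg a)          = cost a ⊕ (one ⊕ one)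
cost (cond c t e)     = cost c ⊕ (cost t ⊕ cost e)
cost (lab l)          = one
cost (switch l a b c) = cost l ⊕ ((cost l ⊕ one) ⊕ (cost c ⊕ cost b) ⊕ cost a)
cost empty            = one
cost (push x xs)      = cost x ⊕ cost xs
cost (match xs e c)   =
  cost xs ⊕ (((cost xs ⊕ one) ⊕ ((cost xs ⊕ one) ⊕ one) ⊕ cost c) ⊕ cost e)
cost (s ,ᵗ t)         = cost s ⊕ cost t
cost (fst t)          = cost t ⊕ one
cost (snd t)          = cost t ⊕ one
cost (both t)         = (one ⊕ one ⊕ cost t) ⊕ (one ⊕ one ⊕ cost t)
cost (f !! b)         = cost b ⊕ ((cost f ⊕ one) ⊕ (cost f ⊕ one))
cost {Γ} (tab t)      =
  foldCost (verticesCost Γ) one ((one ⊕ (one ⊕ one) ⊕ cost t) ⊕ (one ⊕ one))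
cost (f ! i)          = foldCost (cost i) (cost f) tailCost ⊕ one
cost (i <ᵗ j)         = foldCost (cost i) (cost j) tailCost ⊕ (one ⊕ one)
cost {Γ} (for a t)    = foldCost (verticesCost Γ) (cost a) (cost t)
cost (call t as)      = costArgs as ⊕ cost t

costArgs {Γ} []   = verticesCost Γ
costArgs (t ∷ as) = cost t ⊕ costArgs as

-- Correctness of compilation

length-down : ∀ n → length (down n) ≡ n
length-down zero    = refl
length-down (suc n) = cong suc (trans (length-map inject₁ (down n)) (length-down n))

numeral-down : ∀ n → numeral n ≡ encodeList (map (encode vertex) (down n))
numeral-down zero    = refl
numeral-down (suc n) = cong₂ _∙_ (cong numeral (sym (toℕ-fromℕ n)))
  (trans (numeral-down n) (cong encodeList
    (trans (map-cong (λ i → cong numeral (sym (toℕ-inject₁ i))) (down n)) (map-∘ (down n)))))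

tabulate-∷ʳ : ∀ {A : Set} {n} (f : Fin (suc n) → A) xs →
  tabulate f ++ xs ≡ tabulate (f ∘ inject₁) ++ f (fromℕ n) ∷ xs
tabulate-∷ʳ {n = zero}  f xs = refl
tabulate-∷ʳ {n = suc n} f xs = cong (f zero ∷_) (tabulate-∷ʳ (f ∘ suc) xs)

foldl-∷-down : ∀ {A : Set} n (f : Fin n → A) xs →
  foldl (λ acc i → f i ∷ acc) xs (down n) ≡ tabulate f ++ xs
foldl-∷-down zero    f xs = refl
foldl-∷-down (suc n) f xs = trans (foldl-map _ inject₁ _ (down n))
  (trans (foldl-∷-down n (f ∘ inject₁) (f (fromℕ n) ∷ xs)) (sym (tabulate-∷ʳ f xs)))

drop : ℕ → Tree → Tree
drop zero    t = t
drop (suc k) t = drop k (tail t)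

foldl-tail-down : ∀ k t → foldl (λ t _ → tail t) t (down k) ≡ drop k t
foldl-tail-down zero    t = refl
foldl-tail-down (suc k) t = trans (foldl-map _ inject₁ _ (down k)) (foldl-tail-down k (tail t))

head-drop : ∀ {A : Set} (enc : A → Tree) {n} (f : Fin n → A) i →
  head (drop (toℕ i) (encodeList (tabulate λ i → enc (f i)))) ≡ enc (f i)
head-drop enc f zero    = refl
head-drop enc f (suc i) = head-drop enc (f ∘ suc) i

drop-nil : ∀ k → drop k nil ≡ nil
drop-nil zero    = refl
drop-nil (suc k) = drop-nil k

drop-numeral-< : ∀ i j → i < j → ∃[ l ] ∃[ r ] drop i (numeral j) ≡ l ∙ r
drop-numeral-< zero    (suc j) _         = _ , _ , refl
drop-numeral-< (suc i) (suc j) (s≤s i<j) = drop-numeral-< i j i<j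

drop-numeral-≥ : ∀ i j → j ≤ i → drop i (numeral j) ≡ nil
drop-numeral-≥ i       zero    _         = drop-nil i
drop-numeral-≥ (suc i) (suc j) (s≤s j≤i) = drop-numeral-≥ i j j≤i

get-within : ∀ {n Γ} (ρ : Env n Γ) i →
  get (toℕ i) ⊢ encodeEnv ρ ⇓ encode _ (lookupEnv ρ i) within getCost (toℕ i) at n
get-within (v ∷ ρ) zero    = hd-within
get-within (v ∷ ρ) (suc i) = tl-within ⨾-within get-within ρ i

numeral-within : ∀ {n Γ} (ρ : Env n Γ) →
  vertices Γ ⊢ encodeEnv ρ ⇓ numeral n within verticesCost Γ at n
numeral-within []      = var-within
numeral-within (v ∷ ρ) = tl-within ⨾-within numeral-within ρ

vertices-within : ∀ {n Γ} (ρ : Env n Γ) →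
  vertices Γ ⊢ encodeEnv ρ ⇓ encodeList (map (encode vertex) (down n)) within verticesCost Γ at n
vertices-within {n} {Γ} ρ = subst (vertices Γ ⊢ encodeEnv ρ ⇓_within verticesCost Γ at n) (numeral-down _) (numeral-within ρ)

drop-within : ∀ {n p q x s t k y} → k ≤ n → p ⊢ x ⇓ numeral k within s → q ⊢ x ⇓ y within t →
  fold p q (tl ⨾ hd ⨾ tl) ⊢ x ⇓ drop k y
    within suc (suc (s + suc (t + 1)) + suc ((n * (16 + tailCost at n) + 2) + 3))
drop-within {n} {p} {k = k} {y} k≤n num start =
  subst (fold p _ _ ⊢ _ ⇓_within _) (foldl-tail-down k y)
    -- 21 is the overhead 16 of an iteration plus the 5 steps of `tailCost`.
    (weaken (s≤s (+-monoʳ-≤ (suc _) (s≤s (+-monoˡ-≤ 3 (+-monoˡ-≤ 2 (*-monoˡ-≤ 21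
        (≤-trans (≤-reflexive (length-down k)) k≤n)))))))
      (fold-within (encode vertex) id (λ t _ → tail t)
        (λ _ _ → tl-within ⨾-within hd-within ⨾-within (_ , tl , ≤-refl))
        (down k) y (subst (p ⊢ _ ⇓_within _) (numeral-down k) num) start))

fold-vertices-within : ∀ {B : Set} {n Γ} {ρ : Env n Γ} {b i t} {c : Cost}
  (encB : B → Tree) (f : B → Fin n → B) a →
  i ⊢ encodeEnv ρ ⇓ encB a within t →
  (∀ y a → b ⊢ encode vertex y ∙ (encB a ∙ encodeEnv ρ) ⇓ encB (f a y) within c at n) →
  fold (vertices Γ) i b ⊢ encodeEnv ρ ⇓ encB (foldl f a (down n))
    within suc (suc (verticesCost Γ at n + suc (t + 1)) + suc (each c at n + 3))
fold-vertices-within {n = n} {Γ} {ρ} {b} {i} {t} {c} encB f a start step =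
  subst (λ l → fold (vertices Γ) i b ⊢ encodeEnv ρ ⇓ encB (foldl f a (down n)) within
      suc (suc (verticesCost Γ at n + suc (t + 1)) + suc ((l * (16 + c at n) + 2) + 3)))
    (length-down n)
    (fold-within (encode vertex) encB f step (down n) a (vertices-within ρ) start)

-- The bound can depend on n alone because every fold runs over `down n` or over the numeral of a
-- vertex, which has fewer than n elements. Lists of arbitrary length are only taken apart at the
-- head.
run     : ∀ {Γ T n} (e : Term Γ T) (ρ : Env n Γ) →
  compile e ⊢ encodeEnv ρ ⇓ encode T (eval e ρ) within cost e at n
runArgs : ∀ {Γ Δ n} (as : Args Γ Δ) (ρ : Env n Γ) →
  compileArgs as ⊢ encodeEnv ρ ⇓ encodeEnv (evalArgs as ρ) within costArgs as at n

run (var i) ρ = get-within ρ i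
run (bit b) ρ = const-within
run (a and b) ρ with eval a ρ | run a ρ
... | true  | r = if-true-within 1 r (run b ρ)
... | false | r = if-false-within _ r const-within
run (a or b) ρ with eval a ρ | run a ρ
... | true  | r = if-true-within _ r const-within
... | false | r = if-false-within 1 r (run b ρ)
run (neg a) ρ with eval a ρ | run a ρ
... | true  | r = if-true-within 1 r const-within
... | false | r = if-false-within 1 r const-within
run (cond c t e) ρ with eval c ρ | run c ρ
... | true  | r = if-true-within _ r (run t ρ)
... | false | r = if-false-within _ r (run e ρ)
run (lab l) ρ = const-within
run (switch l a b c) ρ with eval l ρ | run l ρ
... | left  | r = if-false-within _ r (run a ρ)
... | right | r = if-true-within _ r (if-false-within _ (r ⨾-within tl-within) (run b ρ))
... | cut   | r = if-true-within _ r (if-true-within _ (r ⨾-within tl-within) (run c ρ))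
run empty ρ = const-within
run (push x xs) ρ = cons-within (run x ρ) (run xs ρ)
run (match xs e c) ρ with eval xs ρ | run xs ρ
... | []     | r = if-false-within _ r (run e ρ)
... | y ∷ ys | r = if-true-within _ r
  (cons-within (r ⨾-within hd-within) (cons-within (r ⨾-within tl-within) var-within)
    ⨾-within run c (y ∷ ys ∷ ρ))
run (s ,ᵗ t) ρ = cons-within (run s ρ) (run t ρ)
run (fst t) ρ = run t ρ ⨾-within hd-within
run (snd t) ρ = run t ρ ⨾-within tl-within
run (both t) ρ =
  cons-within (cons-within const-within var-within ⨾-within run t (false ∷ ρ))
              (cons-within const-within var-within ⨾-within run t (true ∷ ρ))
run (f !! b) ρ with eval b ρ | run b ρ
... | true  | r = if-true-within _ r (run f ρ ⨾-within tl-within)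
... | false | r = if-false-within ((cost f ⊕ one) at _) r (run f ρ ⨾-within hd-within)
run {Γ} {array T} {n} (tab t) ρ =
  subst (compile (tab t) ⊢ encodeEnv ρ ⇓_within cost (tab t) at n)
    (cong encodeList (trans (foldl-∷-down n _ []) (++-identityʳ _)))
    (fold-vertices-within {ρ = ρ} {c = (one ⊕ (one ⊕ one) ⊕ cost t) ⊕ (one ⊕ one)} encodeList
      (λ acc i → encode T (eval t (i ∷ ρ)) ∷ acc) [] const-within
      (λ i acc → cons-within
        (cons-within hd-within (tl-within ⨾-within tl-within) ⨾-within run t (i ∷ ρ))
        (tl-within ⨾-within hd-within)))
run {T = T} {n} (f ! i) ρ =
  subst (compile (f ! i) ⊢ encodeEnv ρ ⇓_within cost (f ! i) at n)
    (head-drop (encode T) (eval f ρ) (eval i ρ))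
    (drop-within (<⇒≤ (toℕ<n (eval i ρ))) (run i ρ) (run f ρ) ⨾-within (_ , hd , ≤-refl))
run {n = n} (i <ᵗ j) ρ = comparison
  where
  a b : ℕ
  a = toℕ (eval i ρ)
  b = toℕ (eval j ρ)
  dropped : fold (compile i) (compile j) (tl ⨾ hd ⨾ tl) ⊢ encodeEnv ρ ⇓ drop a (numeral b)
    within foldCost (cost i) (cost j) tailCost at n
  dropped = drop-within (<⇒≤ (toℕ<n (eval i ρ))) (run i ρ) (run j ρ)
  comparison : compile (i <ᵗ j) ⊢ encodeEnv ρ ⇓ encodeBool (a <ᵇ b) within cost (i <ᵗ j) at n
  comparison with a <ᵇ b | <ᵇ-reflects-< a b
  ... | true  | ofʸ a<b = let (_ , _ , eq) = drop-numeral-< a b a<b in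
    if-true-within 1 (subst (_ ⊢ _ ⇓_within _) eq dropped) const-within
  ... | false | ofⁿ a≮b =
    if-false-within 1 (subst (_ ⊢ _ ⇓_within _) (drop-numeral-≥ a b (≮⇒≥ a≮b)) dropped) const-within
run {T = T} (for a t) ρ =
  fold-vertices-within {ρ = ρ} {c = cost t} (encode T) (λ acc i → eval t (i ∷ acc ∷ ρ)) (eval a ρ) (run a ρ)
    (λ i acc → run t (i ∷ acc ∷ ρ))
run (call t as) ρ = runArgs as ρ ⨾-within run t (evalArgs as ρ)

runArgs []       ρ = numeral-within ρ
runArgs (t ∷ as) ρ = cons-within (run t ρ) (runArgs as ρ)

-- The polynomial part of the algorithm

conflict : Label → Label → Bool
conflict l m =
  choose l (choose m false true false) (choose m true false false) (choose m false false true)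

-- Next to a side the other side is forbidden, next to a cutset vertex the cutset; the Boolean
-- numbers the two labels that remain.
compatible : Label → Bool → Label
compatible l b =
  choose l (Bool.if b then cut else left) (Bool.if b then cut else right) (Bool.if b then right else left)

same : ∀ {n} → Fin n → Fin n → Bool
same i j = not (toℕ i <ᵇ toℕ j) ∧ not (toℕ j <ᵇ toℕ i)

some : ∀ {n} → (Fin n → Bool) → Bool
some {n} f = foldl (λ a i → a ∨ f i) false (down n)

every : ∀ {n} → (Fin n → Bool) → Bool
every {n} f = foldl (λ a i → a ∧ f i) true (down n)

Matrix : ℕ → Set
Matrix n = Fin n → Fin n → Bool

-- Two admissible labels for each vertex.
Lists : ℕ → Set
Lists n = Fin n → Bool → Label

-- The set of dominated vertices together with the admissible labels.
Marking : ℕ → Set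
Marking n = (Fin n → Bool) × Lists n

-- The strings are the guesses still to be read: which corner of the next triangle to mark, and with
-- which label.
State : ℕ → Set
State n = Marking n × (List Label × List Label)

-- `R i b j c` means that taking label number b at i forces label number c at j.
Implication : ℕ → Set
Implication n = Fin n → Bool → Fin n → Bool → Bool

module _ {n : ℕ} where

  pivot : Fin n → Bool → Implication n → Implication n
  pivot k d R i b j c = R i b j c ∨ (R i b k d ∧ R k d j c)

  -- Warshall's algorithm on the implication graph, with both literals of each vertex as pivots.
  closure : Implication n → Implication n
  closure R = foldl (λ R k → pivot k true (pivot k false R)) R (down n)

  -- The classical criterion for 2-SAT: no variable and its negation imply each other.
  consistent : Implication n → Bool
  consistent R = not (some λ i → R i false i true ∧ R i true i false)

  force : Fin n → Fin n → Lists n → Lists n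
  force a b h v d = Bool.if same a v then left else (Bool.if same b v then right else h v d)

module _ {n : ℕ} (adj : Matrix n) where

  triangle : Fin n → Fin n → Fin n → Bool
  triangle x y z = adj x y ∧ (adj y z ∧ adj x z)

  triangleless : Bool
  triangleless = some λ x → not (some λ y → some λ z → triangle x y z)

  -- A later mark may overwrite the list left by an earlier one. This is safe: completeness only
  -- needs the intended label to stay in each list, and the 2-SAT instance checks every edge anyway.
  mark : Fin n → Label → Marking n → Marking n
  mark d l (covered , h) =
    (λ v → same d v ∨ (adj d v ∨ covered v)) ,
    (λ v b → Bool.if same d v then l else (Bool.if adj d v then compatible l b else h v b))

  step : Fin n → Fin n → Fin n → State n → State n
  step x y z s@(m , (ws , ls)) =
    Bool.if not (proj₁ m x) ∧ triangle x y z
    then uncons ws s (λ w ws → uncons ls s (λ l ls → mark (choose w x y z) l m , (ws , ls)))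
    else s

  unmarked : Marking n
  unmarked = (λ _ → false) , (λ _ _ → left)

  walk : List Label → List Label → Marking n
  walk ws ls = proj₁
    (foldl (λ s x → foldl (λ s y → foldl (λ s z → step x y z s) s (down n)) s (down n))
      (unmarked , (ws , ls)) (down n))

  -- Labels do not influence which vertices get covered, so the corner string doubles as a label
  -- string that cannot run out too early.
  dominating : List Label → Bool
  dominating ws = every λ v → proj₁ (walk ws ws) v

  -- If choice b at i conflicts with the opposite of c at j, then b at i forces c at j.
  base : Lists n → Implication n
  base h i b j c = adj i j ∧ conflict (h i b) (h j (not c))

  separable : Lists n → Bool
  separable h = some λ a → some λ b → not (same a b) ∧ consistent (closure (base (force a b h)))

  labelled : List Label → List Label → Bool
  labelled ws ls = separable (proj₂ (walk ws ls))

-- The algorithm as terms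

-- Each term evaluates definitionally to the function above of the same name.

matrixᵗ listsᵗ markingᵗ stateᵗ implicationᵗ : Ty
matrixᵗ      = array (array bool)
listsᵗ       = array (duo label)
markingᵗ     = array bool ⊗ listsᵗ
stateᵗ       = markingᵗ ⊗ list label ⊗ list label
implicationᵗ = array (duo (array (duo bool)))

conflictᵗ : Term (label ∷ label ∷ []) bool
conflictᵗ = switch (# 0)
  (switch (# 1) (bit false) (bit true) (bit false))
  (switch (# 1) (bit true) (bit false) (bit false))
  (switch (# 1) (bit false) (bit false) (bit true))

compatibleᵗ : Term (label ∷ bool ∷ []) label
compatibleᵗ = switch (# 0)
  (cond (# 1) (lab cut) (lab left)) (cond (# 1) (lab cut) (lab right)) (cond (# 1) (lab right) (lab left))

sameᵗ : Term (vertex ∷ vertex ∷ []) bool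
sameᵗ = neg (# 0 <ᵗ # 1) and neg (# 1 <ᵗ # 0)

triangleᵗ : Term (vertex ∷ vertex ∷ vertex ∷ matrixᵗ ∷ []) bool
triangleᵗ = (# 3 ! # 0 ! # 1) and (# 3 ! # 1 ! # 2) and (# 3 ! # 0 ! # 2)

trianglelessᵗ : Term (matrixᵗ ∷ []) bool
trianglelessᵗ =
  for (bit false) (# 1 or neg
    (for (bit false) (# 1 or
      for (bit false) (# 1 or call triangleᵗ (# 4 ∷ # 2 ∷ # 0 ∷ # 6 ∷ [])))))

markᵗ : Term (vertex ∷ label ∷ markingᵗ ∷ matrixᵗ ∷ []) markingᵗ
markᵗ =
  tab (call sameᵗ (# 1 ∷ # 0 ∷ []) or (# 4 ! # 1 ! # 0) or (fst (# 3) ! # 0)) ,ᵗ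
  tab (both (cond (call sameᵗ (# 2 ∷ # 1 ∷ [])) (# 3)
    (cond (# 5 ! # 2 ! # 1) (call compatibleᵗ (# 3 ∷ # 0 ∷ [])) (snd (# 4) ! # 1 !! # 0))))

stepᵗ : Term (vertex ∷ vertex ∷ vertex ∷ stateᵗ ∷ matrixᵗ ∷ []) stateᵗ
stepᵗ =
  cond (neg (fst (fst (# 3)) ! # 0) and call triangleᵗ (# 0 ∷ # 1 ∷ # 2 ∷ # 4 ∷ []))
    (match (fst (snd (# 3))) (# 3) (match (snd (snd (# 5))) (# 5)
      (call markᵗ (switch (# 2) (# 4) (# 5) (# 6) ∷ # 0 ∷ fst (# 7) ∷ # 8 ∷ []) ,ᵗ # 3 ,ᵗ # 1)))
    (# 3)

walkᵗ : Term (list label ∷ list label ∷ matrixᵗ ∷ []) markingᵗ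
walkᵗ = fst
  (for ((tab (bit false) ,ᵗ tab (both (lab left))) ,ᵗ # 0 ,ᵗ # 1)
    (for (# 1) (for (# 1) (call stepᵗ (# 4 ∷ # 2 ∷ # 0 ∷ # 1 ∷ # 8 ∷ [])))))

-- The outer `call` acts as a let: the walk is performed once, not once per vertex.
dominatingᵗ : Term (list label ∷ matrixᵗ ∷ []) bool
dominatingᵗ = call (for (bit true) (# 1 and (fst (# 2) ! # 0))) (call walkᵗ (# 0 ∷ # 0 ∷ # 1 ∷ []) ∷ [])

baseᵗ : Term (listsᵗ ∷ matrixᵗ ∷ []) implicationᵗ
baseᵗ = tab (both (tab (both
  ((# 5 ! # 3 ! # 1) and call conflictᵗ ((# 4 ! # 3 !! # 2) ∷ (# 4 ! # 1 !! neg (# 0)) ∷ [])))))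

pivotᵗ : Term (vertex ∷ bool ∷ implicationᵗ ∷ []) implicationᵗ
pivotᵗ = tab (both (tab (both
  ((# 6 ! # 3 !! # 2 ! # 1 !! # 0) or (# 6 ! # 3 !! # 2 ! # 4 !! # 5) and (# 6 ! # 4 !! # 5 ! # 1 !! # 0)))))

closureᵗ : Term (implicationᵗ ∷ []) implicationᵗ
closureᵗ = for (# 0)
  (call pivotᵗ (# 0 ∷ bit true ∷ call pivotᵗ (# 0 ∷ bit false ∷ # 1 ∷ []) ∷ []))

consistentᵗ : Term (implicationᵗ ∷ []) bool
consistentᵗ = neg (for (bit false)
  (# 1 or (# 2 ! # 0 !! bit false ! # 0 !! bit true) and (# 2 ! # 0 !! bit true ! # 0 !! bit false)))

forceᵗ : Term (vertex ∷ vertex ∷ listsᵗ ∷ []) listsᵗ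
forceᵗ = tab (both (cond (call sameᵗ (# 2 ∷ # 1 ∷ [])) (lab left)
  (cond (call sameᵗ (# 3 ∷ # 1 ∷ [])) (lab right) (# 4 ! # 1 !! # 0))))

separableᵗ : Term (listsᵗ ∷ matrixᵗ ∷ []) bool
separableᵗ = for (bit false) (# 1 or for (bit false) (# 1 or
  neg (call sameᵗ (# 2 ∷ # 0 ∷ [])) and
  call consistentᵗ (call closureᵗ (call baseᵗ (call forceᵗ (# 2 ∷ # 0 ∷ # 4 ∷ []) ∷ # 5 ∷ []) ∷ []) ∷ [])))

labelledᵗ : Term (list label ∷ list label ∷ matrixᵗ ∷ []) bool
labelledᵗ = call separableᵗ (snd (call walkᵗ (# 0 ∷ # 1 ∷ # 2 ∷ [])) ∷ # 2 ∷ [])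

-- 2-satisfiability

∈-down : ∀ {n} (i : Fin n) → i ∈ down n
∈-down {suc n} i with view i
... | ‵fromℕ     = here refl
... | ‵inject₁ j = there (∈-map⁺ inject₁ (∈-down j))

module _ {A : Set} (f : A → Bool) where

  foldl-∨⁺ : ∀ xs {a} → T a ⊎ Any (T ∘ f) xs → T (foldl (λ a x → a ∨ f x) a xs)
  foldl-∨⁺ []       (inj₁ p)         = p
  foldl-∨⁺ (x ∷ xs) (inj₁ p)         = foldl-∨⁺ xs (inj₁ (from T-∨ (inj₁ p)))
  foldl-∨⁺ (x ∷ xs) (inj₂ (here p))  = foldl-∨⁺ xs (inj₁ (from T-∨ (inj₂ p)))
  foldl-∨⁺ (x ∷ xs) (inj₂ (there p)) = foldl-∨⁺ xs (inj₂ p)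

  foldl-∨⁻ : ∀ xs {a} → T (foldl (λ a x → a ∨ f x) a xs) → T a ⊎ Any (T ∘ f) xs
  foldl-∨⁻ []       p = inj₁ p
  foldl-∨⁻ (x ∷ xs) p with foldl-∨⁻ xs p
  ... | inj₂ q = inj₂ (there q)
  ... | inj₁ q with to T-∨ q
  ...   | inj₁ r = inj₁ r
  ...   | inj₂ r = inj₂ (here r)

  foldl-∧⁺ : ∀ xs {a} → T a → All (T ∘ f) xs → T (foldl (λ a x → a ∧ f x) a xs)
  foldl-∧⁺ []       p []       = p
  foldl-∧⁺ (x ∷ xs) p (q ∷ qs) = foldl-∧⁺ xs (from T-∧ (p , q)) qs

  foldl-∧⁻ : ∀ xs {a} → T (foldl (λ a x → a ∧ f x) a xs) → T a × All (T ∘ f) xs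
  foldl-∧⁻ []       p = p , []
  foldl-∧⁻ (x ∷ xs) p = let (q , qs) = foldl-∧⁻ xs p ; (r , r′) = to T-∧ q in r , r′ ∷ qs

some⇔ : ∀ {n} (f : Fin n → Bool) → T (some f) ⇔ ∃ λ i → T (f i)
some⇔ {n} f = mk⇔
  (λ p → [ (λ ()) , Any.satisfied ]′ (foldl-∨⁻ f (down n) p))
  (λ (i , p) → foldl-∨⁺ f (down n) (inj₂ (lose (∈-down i) p)))

every⇔ : ∀ {n} (f : Fin n → Bool) → T (every f) ⇔ (∀ i → T (f i))
every⇔ {n} f = mk⇔
  (λ p i → All.lookup (proj₂ (foldl-∧⁻ f (down n) p)) (∈-down i))
  (λ p → foldl-∧⁺ f (down n) tt (All.universal p (down n)))

T-not : ∀ {b} → T (not b) ⇔ (¬ T b)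
T-not {true}  = mk⇔ (λ ()) (λ ¬t → ⊥-elim (¬t tt))
T-not {false} = mk⇔ (λ _ ()) (λ _ → tt)

same⇔ : ∀ {n} {i j : Fin n} → T (same i j) ⇔ i ≡ j
same⇔ {i = i} {j} = mk⇔
  (λ p → let (i≮j , j≮i) = to T-∧ p in
    toℕ-injective (≤-antisym (≮⇒≥ (to T-not j≮i ∘ <⇒<ᵇ)) (≮⇒≥ (to T-not i≮j ∘ <⇒<ᵇ))))
  (λ { refl → from T-∧ (irr i , irr i) })
  where
  irr : ∀ k → T (not (toℕ k <ᵇ toℕ k))
  irr k = from T-not (n≮n (toℕ k) ∘ <ᵇ⇒< (toℕ k) (toℕ k))

Literal : ℕ → Set
Literal n = Fin n × Bool

flip : ∀ {n} → Literal n → Literal n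
flip (i , b) = i , not b

infix 4 _⊩_

_⊩_ : ∀ {n} → (Fin n → Bool) → Literal n → Set
x ⊩ (i , b) = x i ≡ b

Implies : ∀ {n} → Implication n → Rel (Literal n) 0ℓ
Implies R (i , b) (j , c) = T (R i b j c)

-- A preorder on literals that is stable under contraposition and never
-- identifies a literal with its negation has a model, built by deciding one
-- variable at a time.
module Model {n} {_⇒_ : Rel (Literal n) 0ℓ} (_⇒?_ : Decidable _⇒_)
  (⇒-refl : Reflexive _⇒_) (⇒-trans : Transitive _⇒_)
  (contrapose : ∀ {l m} → l ⇒ flip m → m ⇒ flip l)
  (acyclic : ∀ i → ¬ ((i , false) ⇒ (i , true) × (i , true) ⇒ (i , false))) where

  record Partial : Set₁ where
    field
      Holds      : Pred (Literal n) 0ℓ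
      Holds?     : Pred.Decidable Holds
      closed     : ∀ {l m} → l ⇒ m → Holds l → Holds m
      coherent   : ∀ {l} → Holds l → ¬ Holds (flip l)

    Decided : Fin n → Set
    Decided i = Holds (i , false) ⊎ Holds (i , true)

  open Partial

  -- All consequences of `l` are added. If one of them clashed with `P`, contraposition would put
  -- `flip l` into `P`; if two of them clashed, `l` would imply `flip l`.
  assert : ∀ P l → ¬ Holds P (flip l) → ¬ (l ⇒ flip l) → Partial
  assert P l ¬Pl ¬l⇒ = record
    { Holds      = λ m → Holds P m ⊎ l ⇒ m
    ; Holds?     = λ m → Holds? P m ⊎-dec (l ⇒? m)
    ; closed     = λ { m⇒ (inj₁ p) → inj₁ (closed P m⇒ p) ; m⇒ (inj₂ q) → inj₂ (⇒-trans q m⇒) }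
    ; coherent   = λ where
        (inj₁ p) (inj₁ p′) → coherent P p p′
        (inj₁ p) (inj₂ q)  → ¬Pl (closed P (contrapose q) p)
        (inj₂ q) (inj₁ p)  → ¬Pl (closed P (contrapose (subst (l ⇒_) (sym (flip-flip _)) q)) p)
        (inj₂ q) (inj₂ q′) → ¬l⇒ (⇒-trans q (contrapose q′))
    }
    where
    flip-flip : ∀ (m : Literal n) → flip (flip m) ≡ m
    flip-flip (i , b) = cong (i ,_) (not-involutive b)

  decide : ∀ P i → ∃ λ P′ → (∀ {l} → Holds P l → Holds P′ l) × Decided P′ i
  decide P i with Holds? P (i , false) | Holds? P (i , true) | (i , false) ⇒? (i , true)
  ... | yes p | _     | _     = P , id , inj₁ p
  ... | no _  | yes p | _     = P , id , inj₂ p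
  -- False implies true here, so only true can be asserted; by acyclicity true does not imply false.
  ... | no ¬f | no ¬t | yes q = assert P (i , true) ¬f (λ r → acyclic i (q , r)) , inj₁ , inj₂ (inj₂ ⇒-refl)
  ... | no ¬f | no ¬t | no ¬q = assert P (i , false) ¬t ¬q , inj₁ , inj₁ (inj₂ ⇒-refl)

  decideAll : ∀ P is → ∃ λ P′ → (∀ {l} → Holds P l → Holds P′ l) × All (Decided P′) is
  decideAll P []       = P , id , []
  decideAll P (i ∷ is) =
    let (P′ , ext , ds) = decideAll P is
        (P″ , ext′ , d) = decide P′ i
    in P″ , ext′ ∘ ext , d ∷ All.map [ inj₁ ∘ ext′ , inj₂ ∘ ext′ ]′ ds

  model : ∃ λ x → ∀ {l m} → l ⇒ m → x ⊩ l → x ⊩ m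
  model = x , λ {l} {m} l⇒m xl → Holds⇒⊩ m (closed P l⇒m (⊩⇒Holds l xl))
    where
    nothing : Partial
    nothing = record { Holds = λ _ → ⊥ ; Holds? = λ _ → no id ; closed = λ _ () ; coherent = λ () }
    all : ∃ λ P′ → _ × All (Decided P′) (down n)
    all = decideAll nothing (down n)
    P : Partial
    P = proj₁ all
    decided : ∀ i → Decided P i
    decided i = All.lookup (proj₂ (proj₂ all)) (∈-down i)
    x : Fin n → Bool
    x i = [ (λ _ → false) , (λ _ → true) ]′ (decided i)
    ⊩⇒Holds : ∀ l → x ⊩ l → Holds P l
    ⊩⇒Holds (i , b) eq with decided i
    ⊩⇒Holds (i , .false) refl | inj₁ p = p
    ⊩⇒Holds (i , .true)  refl | inj₂ p = p
    Holds⇒⊩ : ∀ l → Holds P l → x ⊩ l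
    Holds⇒⊩ (i , b) p with decided i
    Holds⇒⊩ (i , false) p | inj₁ q = refl
    Holds⇒⊩ (i , true)  p | inj₁ q = ⊥-elim (coherent P q p)
    Holds⇒⊩ (i , false) p | inj₂ q = ⊥-elim (coherent P p q)
    Holds⇒⊩ (i , true)  p | inj₂ q = refl

conflict-sym : ∀ l m → T (conflict l m) → T (conflict m l)
conflict-sym left  right _ = tt
conflict-sym right left  _ = tt
conflict-sym cut   cut   _ = tt

module _ {n : ℕ} where

  pivot⁺ : ∀ (k : Fin n) d R l m → Implies R l m ⊎ (Implies R l (k , d) × Implies R (k , d) m) →
    Implies (pivot k d R) l m
  pivot⁺ k d R l m (inj₁ p) = from T-∨ (inj₁ p)
  pivot⁺ k d R l m (inj₂ p) = from T-∨ (inj₂ (from T-∧ p))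

  pivot⁻ : ∀ (k : Fin n) d R l m → Implies (pivot k d R) l m →
    Implies R l m ⊎ (Implies R l (k , d) × Implies R (k , d) m)
  pivot⁻ k d R l m p with to T-∨ p
  ... | inj₁ q = inj₁ q
  ... | inj₂ q = inj₂ (to T-∧ q)

  ClosedAt : Literal n → Implication n → Set
  ClosedAt p R = ∀ l m → Implies R l p → Implies R p m → Implies R l m

  -- Pivoting on a literal creates no new arrow into it or out of it.
  pivot-closed : ∀ k d R → ClosedAt (k , d) (pivot k d R)
  pivot-closed k d R l m p q = pivot⁺ k d R l m (inj₂
    ([ id , proj₁ ]′ (pivot⁻ k d R l (k , d) p) , [ id , proj₂ ]′ (pivot⁻ k d R (k , d) m q)))

  -- Warshall's invariant. If both halves of the path use the pivot, the first reaches it and the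
  -- second leaves it, so the detour through `p` can be cut out.
  pivot-preserves : ∀ k d R p → ClosedAt p R → ClosedAt p (pivot k d R)
  pivot-preserves k d R p c l m lp pm with pivot⁻ k d R l p lp | pivot⁻ k d R p m pm
  ... | inj₁ q        | inj₁ r        = pivot⁺ k d R l m (inj₁ (c l m q r))
  ... | inj₁ q        | inj₂ (r , r′) = pivot⁺ k d R l m (inj₂ (c l (k , d) q r , r′))
  ... | inj₂ (q , q′) | inj₁ r        = pivot⁺ k d R l m (inj₂ (q , c (k , d) m q′ r))
  ... | inj₂ (q , _)  | inj₂ (_ , r′) = pivot⁺ k d R l m (inj₂ (q , r′))

  pivots : Implication n → List (Fin n) → Implication n
  pivots = foldl (λ R k → pivot k true (pivot k false R))

  pivots-preserves : ∀ ks R p → ClosedAt p R → ClosedAt p (pivots R ks)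
  pivots-preserves [] R p      c = c
  pivots-preserves (k ∷ ks) R p c =
    pivots-preserves ks _ p (pivot-preserves k true _ p (pivot-preserves k false R p c))

  pivots-closed : ∀ {ks k} R → k ∈ ks → ∀ d → ClosedAt (k , d) (pivots R ks)
  pivots-closed {k ∷ ks} R (here refl) false =
    pivots-preserves ks _ (k , false) (pivot-preserves k true _ (k , false) (pivot-closed k false R))
  pivots-closed {k ∷ ks} R (here refl) true  =
    pivots-preserves ks _ (k , true) (pivot-closed k true (pivot k false R))
  pivots-closed          R (there k∈) d     = pivots-closed _ k∈ d

  pivots-extensive : ∀ ks R l m → Implies R l m → Implies (pivots R ks) l m
  pivots-extensive []       R l m p = p
  pivots-extensive (k ∷ ks) R l m p = pivots-extensive ks _ l m
    (pivot⁺ k true (pivot k false R) l m (inj₁ (pivot⁺ k false R l m (inj₁ p))))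

  -- Serves as the induction principle for `closure`, once with `Q` the contraposed closure and once
  -- with `Q` the preservation of truth under an assignment.
  pivots-least : ∀ {Q : Rel (Literal n) 0ℓ} → Transitive Q → ∀ ks R →
    (∀ l m → Implies R l m → Q l m) → ∀ l m → Implies (pivots R ks) l m → Q l m
  pivots-least {Q} Q-trans = least
    where
    pivot-least : ∀ k d R → (∀ l m → Implies R l m → Q l m) →
      ∀ l m → Implies (pivot k d R) l m → Q l m
    pivot-least k d R R⊆Q l m p with pivot⁻ k d R l m p
    ... | inj₁ q        = R⊆Q l m q
    ... | inj₂ (q , q′) = Q-trans (R⊆Q l (k , d) q) (R⊆Q (k , d) m q′)
    least : ∀ ks R → (∀ l m → Implies R l m → Q l m) → ∀ l m → Implies (pivots R ks) l m → Q l m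
    least []       R R⊆Q = R⊆Q
    least (k ∷ ks) R R⊆Q = least ks _ (pivot-least k true _ (pivot-least k false R R⊆Q))

module _ {n : ℕ} {adj : Matrix n} where

  Proper : (Fin n → Label) → Set
  Proper f = ∀ {u v} → T (adj u v) → ¬ T (conflict (f u) (f v))

  Proper-resp : ∀ {f g} → (∀ v → f v ≡ g v) → Proper f → Proper g
  Proper-resp f≗g proper {u} {v} uv c =
    proper uv (subst₂ (λ l m → T (conflict l m)) (sym (f≗g u)) (sym (f≗g v)) c)

  module _ (adj-sym : ∀ {u v} → T (adj u v) → T (adj v u)) (h : Lists n) where

    private
      R R* : Implication n
      R  = base adj h
      R* = closure R

      R*-trans : Transitive (Implies R*)
      R*-trans {l} {k , d} {m} = pivots-closed R (∈-down k) d l m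

      -- The contraposed closure is transitive, and it contains `R` because adjacency and conflict
      -- are symmetric.
      contrapose : ∀ l m → Implies R* l (flip m) → Implies R* m (flip l)
      contrapose l m@(j , c) p =
        subst (λ c → Implies R* (j , c) (flip l)) (not-involutive c)
          (pivots-least {Q = λ l m → Implies R* (flip m) (flip l)}
            (λ {l m k} p q → R*-trans {flip k} {flip m} {flip l} q p) (down n) R R⊆ l (flip m) p)
        where
        R⊆ : ∀ l m → Implies R l m → Implies R* (flip m) (flip l)
        R⊆ l@(i , b) m@(j , c) p = pivots-extensive (down n) R (flip m) (flip l)
          (let (ij , bad) = to T-∧ p in from T-∧ (adj-sym ij ,
            subst (λ b → T (conflict (h j (not c)) (h i b))) (sym (not-involutive b)) (conflict-sym (h i b) (h j (not c)) bad)))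

    consistent⇔ : T (consistent R*) ⇔ ∃ λ x → Proper (λ v → h v (x v))
    consistent⇔ = mk⇔ sound complete
      where
      sound : T (consistent R*) → ∃ λ x → Proper (λ v → h v (x v))
      -- A conflict on the edge is an implication from the choice at `u` to the opposite of the
      -- choice at `v`.
      sound ok = x , λ {u} {v} uv bad → not-¬ refl (x-closed {u , x u} {v , not (x v)}
        (inj₂ (pivots-extensive (down n) R (u , x u) (v , not (x v)) (from T-∧ (uv ,
          subst (λ b → T (conflict (h u (x u)) (h v b))) (sym (not-involutive (x v))) bad)))) refl)
        where
        -- `Model` wants a preorder, but the closure is only transitive; equality is added.
        _⇒_ : Rel (Literal n) 0ℓ
        l ⇒ m = l ≡ m ⊎ Implies R* l m
        ⇒-trans : Transitive _⇒_
        ⇒-trans (inj₁ refl) q           = q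
        ⇒-trans (inj₂ p)    (inj₁ refl) = inj₂ p
        ⇒-trans {l} {m} {k} (inj₂ p) (inj₂ q) = inj₂ (R*-trans {l} {m} {k} p q)
        ⇒-contrapose : ∀ {l m} → l ⇒ flip m → m ⇒ flip l
        ⇒-contrapose {m = j , c} (inj₁ refl) = inj₁ (cong (j ,_) (sym (not-involutive c)))
        ⇒-contrapose             (inj₂ p)    = inj₂ (contrapose _ _ p)
        _⇒?_ : Decidable _⇒_
        l ⇒? m = ≡-dec Fin._≟_ Bool._≟_ l m ⊎-dec T? _
        ⇒-acyclic : ∀ i → ¬ ((i , false) ⇒ (i , true) × (i , true) ⇒ (i , false))
        ⇒-acyclic i (inj₂ p , inj₂ q) = to T-not ok (from (some⇔ _) (i , from T-∧ (p , q)))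
        open Model _⇒?_ (inj₁ refl) ⇒-trans ⇒-contrapose ⇒-acyclic
        x : Fin n → Bool
        x = proj₁ model
        x-closed : ∀ {l m} → l ⇒ m → x ⊩ l → x ⊩ m
        x-closed = proj₂ model
      complete : (∃ λ x → Proper (λ v → h v (x v))) → T (consistent R*)
      complete (x , proper) = from T-not λ bad → let (i , p) = to (some⇔ _) bad ; (q , q′) = to T-∧ p in
        contradictory i (sat _ _ q) (sat _ _ q′)
        where
        respects : ∀ l m → Implies R l m → x ⊩ l → x ⊩ m
        respects (i , b) (j , c) p refl with x j Bool.≟ c
        ... | yes eq = eq
        ... | no neq = let (ij , bad) = to T-∧ p in
          contradiction (subst (λ b → T (conflict (h i (x i)) (h j b))) (sym (¬-not neq)) bad) (proper ij)
        sat : ∀ l m → Implies R* l m → x ⊩ l → x ⊩ m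
        sat = pivots-least {Q = λ l m → x ⊩ l → x ⊩ m} (λ p q → q ∘ p) (down n) R respects
        contradictory : ∀ i → (x i ≡ false → x i ≡ true) → (x i ≡ true → x i ≡ false) → ⊥
        contradictory i p q with x i
        ... | false = contradiction (p refl) λ ()
        ... | true  = contradiction (q refl) λ ()

-- Branching on triangles

same-refl : ∀ {n} (i : Fin n) → T (same i i)
same-refl i = from (same⇔ {i = i}) refl

compatible-complete : ∀ l m → ¬ T (conflict l m) → ∃ λ b → compatible l b ≡ m
compatible-complete left  left  _ = false , refl
compatible-complete left  right p = contradiction tt p
compatible-complete left  cut   _ = true , refl
compatible-complete right left  p = contradiction tt p
compatible-complete right right _ = false , refl
compatible-complete right cut   _ = true , refl
compatible-complete cut   left  _ = false , refl
compatible-complete cut   right _ = true , refl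
compatible-complete cut   cut   p = contradiction tt p

-- Applied twice, it flattens the triple loop of `walk` into one fold over `triples`, on which the
-- inductions run.
foldl-product : ∀ {A B C : Set} (f : C → A × B → C) c xs ys →
  foldl (λ c x → foldl (λ c y → f c (x , y)) c ys) c xs ≡ foldl f c (cartesianProduct xs ys)
foldl-product f c []       ys = refl
foldl-product f c (x ∷ xs) ys = trans (foldl-product f _ xs ys)
  (trans (cong (λ c → foldl f c (cartesianProduct xs ys)) (sym (foldl-map f (x ,_) c ys)))
    (sym (foldl-++ f c (map (x ,_) ys) (cartesianProduct xs ys))))

triples : ∀ n → List (Fin n × Fin n × Fin n)
triples n = cartesianProduct (down n) (cartesianProduct (down n) (down n))

∈-triples : ∀ {n} (t : Fin n × Fin n × Fin n) → t ∈ triples n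
∈-triples (x , y , z) = ∈-cartesianProduct⁺ (∈-down x) (∈-cartesianProduct⁺ (∈-down y) (∈-down z))

module _ {n : ℕ} (adj : Matrix n) (adj-sym : ∀ {u v} → T (adj u v) → T (adj v u)) where

  record Separation : Set where
    constructor separation
    field
      labels  : Fin n → Label
      proper  : Proper {adj = adj} labels
      {a b}   : Fin n
      a-left  : labels a ≡ left
      b-right : labels b ≡ right

  steps : State n → List (Fin n × Fin n × Fin n) → State n
  steps = foldl (λ { s (x , y , z) → step adj x y z s })

  walk-steps : ∀ ws ls → walk adj ws ls ≡ proj₁ (steps (unmarked adj , (ws , ls)) (triples n))
  walk-steps ws ls = cong proj₁ (trans
    (foldl-cong (λ s x → foldl-product (λ { s (y , z) → step adj x y z s }) s (down n) (down n)) _ (down n))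
    (foldl-product (λ { s (x , y , z) → step adj x y z s }) _ (down n) (cartesianProduct (down n) (down n))))

  Covered : State n → Fin n → Set
  Covered s v = T (proj₁ (proj₁ s) v)

  mark-covers : ∀ d l m {v} → T (proj₁ m v) → T (proj₁ (mark adj d l m) v)
  mark-covers d l m {v} p = from (T-∨ {same d v}) (inj₂ (from (T-∨ {adj d v}) (inj₂ p)))

  step-covers : ∀ x y z s {v} → Covered s v → Covered (step adj x y z s) v
  step-covers x y z s@(m , (ws , ls)) p with not (proj₁ m x) ∧ triangle adj x y z
  ... | false = p
  ... | true with ws | ls
  ...   | []    | _     = p
  ...   | _ ∷ _ | []    = p
  ...   | w ∷ _ | l ∷ _ = mark-covers (choose w x y z) l m p

  steps-cover : ∀ ts s {v} → Covered s v → Covered (steps s ts) v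
  steps-cover []                s p = p
  steps-cover ((x , y , z) ∷ ts) s p = steps-cover ts _ (step-covers x y z s p)

  corner-covers : ∀ {l x y z k} m → T (triangle adj x y z) → T (proj₁ (mark adj (choose l x y z) k m) x)
  corner-covers {left} {x} m p = from T-∨ (inj₁ (same-refl x))
  corner-covers {right} {x} {y} m p = from (T-∨ {same y x}) (inj₂ (from T-∨ (inj₁ (adj-sym (proj₁ (to T-∧ p))))))
  corner-covers {cut} {x} {y} {z} m p =
    from (T-∨ {same z x}) (inj₂ (from T-∨ (inj₁ (adj-sym (proj₂ (to (T-∧ {adj y z}) (proj₂ (to (T-∧ {adj x y}) p))))))))

  Hits : (Fin n → Bool) → Subset n → Set
  Hits c X = ∀ x y z → T (triangle adj x y z) → ¬ T (c x) → ∃ λ l → choose l x y z ∈ₛ X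

  -- Branching on a triangle with an uncovered vertex, some branch marks a
  -- vertex of X, which can then be removed from X.
  covering-string : ∀ ts c h X m → Hits c X → ∣ X ∣ ≤ m →
    ∃ λ ws → length ws ≡ m × (∀ {x y z} → (x , y , z) ∈ ts → T (triangle adj x y z) →
      Covered (steps ((c , h) , (ws , ws)) ts) x)
  -- The padding makes the length exactly `m`, as a level enumerates strings of one length only.
  covering-string [] c h X m hits X≤m = replicate m left , length-replicate m , λ ()
  covering-string ((x , y , z) ∷ ts) c h X m hits X≤m
    with not (c x) ∧ triangle adj x y z in eq
  ... | false =
    let (ws , len , cov) = covering-string ts c h X m hits X≤m
    in ws , len , λ where
      (here refl) t → steps-cover ts _ (covered t)
      (there t∈)  t → cov t∈ t
    where
    covered : T (triangle adj x y z) → T (c x)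
    covered t with c x
    ... | true  = tt
    ... | false = subst T eq t
  ... | true with hits x y z (proj₂ (to (T-∧ {not (c x)}) (from T-≡ eq))) (to T-not (proj₁ (to T-∧ (from T-≡ eq))))
  ...   | l , d∈X with m | ≤-trans (x∈p⇒∣p-x∣<∣p∣ d∈X) X≤m
  ...     | suc m | s≤s X-d≤m =
    let d = choose l x y z
        (c′ , h′) = mark adj d l (c , h)
        (ws , len , cov) = covering-string ts c′ h′ (X - d) m
          (λ x′ y′ z′ t ¬c′ →
            let (l′ , d′∈X) = hits x′ y′ z′ t (λ p → ¬c′ (mark-covers d l (c , h) p))
            -- Were this corner the removed vertex `d`, marking `d` would have covered `x′`.
            in l′ , x∈p∧x≢y⇒x∈p-y d′∈X (λ d′≡d → ¬c′
                 (subst (λ d → T (proj₁ (mark adj d l (c , h)) x′)) d′≡d (corner-covers {l′} {k = l} (c , h) t))))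
          X-d≤m
    in l ∷ ws , cong suc len , λ where
      (here refl) t → steps-cover ts _ (corner-covers {l} {k = l} (c , h) t)
      (there t∈)  t → cov t∈ t

  Admits : (Fin n → Label) → Marking n → Set
  Admits f (c , h) = ∀ v → T (c v) → ∃ λ b → h v b ≡ f v

  mark-admits : ∀ {f} → Proper {adj = adj} f → ∀ d m → Admits f m → Admits f (mark adj d (f d) m)
  mark-admits {f} proper d m@(c , h) admits v p with same d v in d≡v | adj d v in dv
  ... | true  | _     = false , cong f (to same⇔ (from T-≡ d≡v))
  ... | false | true  = compatible-complete (f d) (f v) (proper (from T-≡ dv))
  ... | false | false = admits v p

  -- Each marked vertex gets its label under `f`, so `f` survives in all lists. The two walks differ
  -- only in their lists, `h` and `h′`, and therefore mark the same vertices. The label string is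
  -- padded to length `m`, since `ws` may be shorter.
  labelling-string : ∀ {f} → Proper {adj = adj} f → ∀ ts c h h′ ws m → Admits f (c , h) → length ws ≤ m →
    ∃ λ ls → length ls ≡ m × Admits f (proj₁ (steps ((c , h) , (ws , ls)) ts)) ×
      (∀ v → Covered (steps ((c , h′) , (ws , ws)) ts) v → Covered (steps ((c , h) , (ws , ls)) ts) v)
  labelling-string proper [] c h h′ ws m admits ws≤m =
    replicate m left , length-replicate m , admits , λ _ p → p
  labelling-string {f} proper ((x , y , z) ∷ ts) c h h′ ws m admits ws≤m
    with not (c x) ∧ triangle adj x y z
  labelling-string {f} proper ((x , y , z) ∷ ts) c h h′ ws m admits ws≤m | false =
    labelling-string proper ts c h h′ ws m admits ws≤m
  labelling-string {f} proper ((x , y , z) ∷ ts) c h h′ [] m admits ws≤m | true =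
    labelling-string proper ts c h h′ [] m admits ws≤m
  labelling-string {f} proper ((x , y , z) ∷ ts) c h h′ (w ∷ ws) (suc m) admits (s≤s ws≤m) | true =
    let d = choose w x y z
        (c₁ , h₁) = mark adj d (f d) (c , h)
        (ls , len , rest) = labelling-string proper ts c₁ h₁ (proj₂ (mark adj d w (c , h′))) ws m
          (mark-admits proper d (c , h) admits) ws≤m
    in f d ∷ ls , cong suc len , rest

  separable⁻ : ∀ h → T (separable adj h) → Separation
  separable⁻ h p =
    let (a , p) = to (some⇔ _) p
        (b , p) = to (some⇔ _) p
        (a≢b , p) = to T-∧ p
        (x , proper) = to (consistent⇔ adj-sym (force a b h)) p
    in separation (λ v → force a b h v (x v)) proper {a} {b}
         (forced-left a b (x a)) (forced-right a b (x b) (to T-not a≢b))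
    where
    forced-left : ∀ a b d → force a b h a d ≡ left
    forced-left a b d with same a a | same-refl a
    ... | true | _ = refl
    forced-right : ∀ a b d → ¬ T (same a b) → force a b h b d ≡ right
    forced-right a b d a≢b with same a b
    ... | true = contradiction tt a≢b
    ... | false with same b b | same-refl b
    ...   | true | _ = refl

  separable⁺ : ∀ h (s : Separation) → (∀ v → ∃ λ d → h v d ≡ Separation.labels s v) → T (separable adj h)
  separable⁺ h (separation f proper {a} {b} fa fb) admits =
    from (some⇔ _) (a , from (some⇔ _) (b , from T-∧ (from T-not a≢b ,
      from (consistent⇔ adj-sym (force a b h)) (x , Proper-resp {adj = adj} (sym ∘ forced) proper))))
    where
    a≢b : ¬ T (same a b)
    a≢b p = case trans (sym fa) (trans (cong f (to same⇔ p)) fb) of λ ()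
    x : Fin n → Bool
    x v = proj₁ (admits v)
    forced : ∀ v → force a b h v (x v) ≡ f v
    forced v with same a v in a≡v | same b v in b≡v
    ... | true  | _     = trans (sym fa) (cong f (to same⇔ (from T-≡ a≡v)))
    ... | false | true  = trans (sym fb) (cong f (to same⇔ (from T-≡ b≡v)))
    ... | false | false = proj₂ (admits v)

  dominating⁺ : ∀ {X m} → (∀ x → ∃ λ y → ∃ λ z → T (triangle adj x y z)) → Hits (λ _ → false) X → ∣ X ∣ ≤ m →
    ∃ λ ws → length ws ≡ m × T (dominating adj ws)
  dominating⁺ {X} {m} triangles hits X≤m =
    let (ws , len , cov) = covering-string (triples n) (λ _ → false) (λ _ _ → left) X m hits X≤m
    in ws , len , from (every⇔ _) (λ x → let (y , z , t) = triangles x in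
         subst (λ m → T (proj₁ m x)) (sym (walk-steps ws ws)) (cov (∈-triples (x , y , z)) t))

  labelled⁻ : ∀ ws ls → T (labelled adj ws ls) → Separation
  labelled⁻ ws ls = separable⁻ (proj₂ (walk adj ws ls))

  labelled⁺ : ∀ ws m → T (dominating adj ws) → length ws ≤ m → Separation →
    ∃ λ ls → length ls ≡ m × T (labelled adj ws ls)
  labelled⁺ ws m dom ws≤m s =
    let (ls , len , admits , cov) = labelling-string proper (triples n) (λ _ → false) (λ _ _ → left) (λ _ _ → left)
          ws m (λ _ ()) ws≤m
    in ls , len , separable⁺ _ s (λ v →
         subst (λ m → ∃ λ d → proj₂ m v d ≡ labels v) (sym (walk-steps ws ls)) (admits v (cov v
           (subst (λ m → T (proj₁ m v)) (walk-steps ws ws) (to (every⇔ _) dom v)))))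
    where open Separation s

-- Independent cutsets as labellings

T-does⇔ : ∀ {P : Set} (P? : Dec P) → T (does P?) ⇔ P
T-does⇔ (yes p) = mk⇔ (λ _ → p) (λ _ → tt)
T-does⇔ (no ¬p) = mk⇔ (λ ()) ¬p′
  where ¬p′ = ⊥-elim ∘ ¬p

-- Double-negation shift, which holds because the domain is finite.
¬¬-∀ : ∀ {n} {P : Fin n → Set} → (∀ i → ¬ ¬ P i) → ¬ ¬ (∀ i → P i)
¬¬-∀ {zero}  ¬¬p k = k λ ()
¬¬-∀ {suc n} ¬¬p k =
  ¬¬p zero λ p₀ → ¬¬-∀ (¬¬p ∘ suc) λ p₊ → k λ { zero → p₀ ; (suc i) → p₊ i }

is-cut : Label → Bool
is-cut cut = true
is-cut _   = false

module _ {n : ℕ} (G : Graph (Fin n)) where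
  open Graph G renaming (sym to ~-sym)

  adj : Matrix n
  adj u v = does (u ~? v)

  adj⇔ : ∀ {u v} → T (adj u v) ⇔ u ~ v
  adj⇔ {u} {v} = T-does⇔ (u ~? v)

  adj-sym : ∀ {u v} → T (adj u v) → T (adj v u)
  adj-sym = from adj⇔ ∘ ~-sym ∘ to adj⇔

  separation⇒cutset : Separation adj adj-sym → HasIndependentCutset G
  separation⇒cutset (separation f proper {a} {b} fa fb) = S , disconnected , independent
    where
    S : Subset n
    S = Vec.tabulate (is-cut ∘ f)
    ∈S⇒cut : ∀ {v} → v ∈ₛ S → f v ≡ cut
    ∈S⇒cut {v} v∈ with f v | trans (sym (lookup∘tabulate (is-cut ∘ f) v)) ([]=⇒lookup v∈)
    ... | cut | _ = refl
    cut⇒∈S : ∀ {v} → f v ≡ cut → v ∈ₛ S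
    cut⇒∈S {v} eq = lookup⇒[]= v S (trans (lookup∘tabulate (is-cut ∘ f) v) (cong is-cut eq))
    independent : Independent G S
    independent u∈ v∈ uv = proper (from adj⇔ uv)
      (subst₂ (λ l m → T (conflict l m)) (sym (∈S⇒cut u∈)) (sym (∈S⇒cut v∈)) tt)
    stays-left : ∀ {u v} → Star (Graph._~_ (G − S)) u v → f (proj₁ u) ≡ left → f (proj₁ v) ≡ left
    stays-left ε fu = fu
    stays-left {u , _} (_◅_ {j = v , v∉} uv path) fu = stays-left path fv
      where
      fv : f v ≡ left
      fv with f v in eq
      ... | left  = refl
      ... | right = contradiction (subst₂ (λ l m → T (conflict l m)) (sym fu) (sym eq) tt) (proper (from adj⇔ uv))
      ... | cut   = contradiction (cut⇒∈S eq) v∉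
    uncut : ∀ {v l} → f v ≡ l → l ≢ cut → v ∉ S
    uncut eq l≢ v∈ = l≢ (trans (sym eq) (∈S⇒cut v∈))
    disconnected : Cutset G S
    disconnected connected =
      case trans (sym fb) (stays-left (connected (a , uncut fa λ ()) (b , uncut fb λ ())) fa) of λ ()

  -- The components of G − S cannot be computed without deciding
  -- reachability, which is harmless in a proof of ⊥.
  cutset⇒¬¬separation : HasIndependentCutset G → ¬ ¬ Separation adj adj-sym
  cutset⇒¬¬separation (S , disconnected , independent) none =
    ¬¬-∀ (λ u → ¬¬-∀ (joined u)) λ all → disconnected λ (u , u∉) (v , v∉) → all u v u∉ v∉
    where
    module H = Graph (G − S)
    Reach : ∃ (_∉ S) → Fin n → Set
    Reach u v = ∃ λ v∉ → Star H._~_ u (v , v∉)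

    separate : ∀ u v → ¬ Star H._~_ u v → (∀ w → Dec (Reach u w)) → Separation adj adj-sym
    separate u@(u₀ , u∉) v@(v₀ , v∉) ¬path reach? = separation f proper fu fv
      where
      f : Fin n → Label
      f w with w ∈? S | reach? w
      ... | yes _ | _     = cut
      ... | no _  | yes _ = left
      ... | no _  | no _  = right
      fu : f u₀ ≡ left
      fu with u₀ ∈? S | reach? u₀
      ... | yes u∈ | _     = contradiction u∈ u∉
      ... | no _   | yes _ = refl
      ... | no _   | no ¬r = ⊥-elim (¬r (u∉ , ε))
      fv : f v₀ ≡ right
      fv with v₀ ∈? S | reach? v₀
      ... | yes v∈ | _           = contradiction v∈ v∉
      ... | no _   | yes (_ , p) = ⊥-elim (¬path p)
      ... | no _   | no _        = refl
      proper : Proper {adj = adj} f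
      proper {x} {y} xy bad with x ∈? S | y ∈? S | reach? x | reach? y
      ... | yes x∈ | yes y∈ | _ | _ = independent x∈ y∈ (to adj⇔ xy)
      ... | yes _  | no _   | _ | yes _ = bad
      ... | yes _  | no _   | _ | no _  = bad
      ... | no _   | yes _  | yes _ | _ = bad
      ... | no _   | yes _  | no _  | _ = bad
      ... | no _   | no y∉  | yes (_ , p) | no ¬r = ¬r (y∉ , p ◅◅ to adj⇔ xy ◅ ε)
      ... | no x∉  | no _   | no ¬r | yes (_ , p) = ¬r (x∉ , p ◅◅ ~-sym (to adj⇔ xy) ◅ ε)
      ... | no _   | no _   | yes _ | yes _ = bad
      ... | no _   | no _   | no _  | no _  = bad

    joined : ∀ u v → ¬ ¬ (∀ u∉ v∉ → Star H._~_ (u , u∉) (v , v∉))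
    joined u v k with u ∈? S | v ∈? S
    ... | yes u∈ | _      = k λ u∉ → contradiction u∈ u∉
    ... | no _   | yes v∈ = k λ _ v∉ → contradiction v∈ v∉
    -- Proofs of ⊥, hence of u ∉ S, are definitionally equal.
    ... | no u∉  | no v∉  = ¬¬-∀ {P = λ w → Dec (Reach (u , u∉) w)} (λ _ → ¬¬-excluded-middle)
      λ reach? → none (separate (u , u∉) (v , v∉) (λ path → k λ _ _ → path) reach?)

  triangle⁺ : ∀ {x y z} → x ~ y → y ~ z → x ~ z → T (triangle adj x y z)
  triangle⁺ xy yz xz = from T-∧ (from adj⇔ xy , from T-∧ (from adj⇔ yz , from adj⇔ xz))

  triangle⁻ : ∀ {x y z} → T (triangle adj x y z) → x ~ y × y ~ z × x ~ z
  triangle⁻ {x} {y} {z} p =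
    let (xy , p) = to (T-∧ {adj x y}) p ; (yz , xz) = to (T-∧ {adj y z}) p
    in to adj⇔ xy , to adj⇔ yz , to adj⇔ xz

  transversal-hits : ∀ {X} → OddCycleTransversal G X → Hits adj adj-sym (λ _ → false) X
  transversal-hits {X} (side , proper) x y z t _ with x ∈? X | y ∈? X | z ∈? X
  ... | yes x∈ | _      | _      = left , x∈
  ... | no _   | yes y∈ | _      = right , y∈
  ... | no _   | no _   | yes z∈ = cut , z∈
  ... | no x∉  | no y∉  | no z∉  = let (xy , yz , xz) = triangle⁻ t in
    -- Both `x` and `z` lie on the side opposite to `y`, although they are adjacent.
    contradiction (trans (¬-not (proper {x , x∉} {y , y∉} xy)) (sym (¬-not (proper {z , z∉} {y , y∉} (~-sym yz)))))
      (proper {x , x∉} {z , z∉} xz)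

  triangleless⇔ : T (triangleless adj) ⇔ ∃ λ x → ∀ y z → ¬ T (triangle adj x y z)
  triangleless⇔ = mk⇔
    (λ p → let (x , p) = to (some⇔ _) p in
      x , λ y z t → to T-not p (from (some⇔ _) (y , from (some⇔ _) (z , t))))
    (λ (x , ¬t) → from (some⇔ _) (x , from T-not λ p →
      let (y , p) = to (some⇔ _) p ; (z , t) = to (some⇔ _) p in ¬t y z t))

  ¬triangleless : ¬ T (triangleless adj) → ∀ x → ∃ λ y → ∃ λ z → T (triangle adj x y z)
  ¬triangleless ¬p x with any? (λ y → any? (λ z → T? (triangle adj x y z)))
  ... | yes t = t
  ... | no ¬t = contradiction (from triangleless⇔ (x , λ y z t → ¬t (y , z , t))) ¬p

  -- The neighbourhood of x is independent. It separates x from the other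
  -- vertices, unless G is a star with centre x.
  triangleless-separation : 3 ≤ n → T (triangleless adj) → Separation adj adj-sym
  triangleless-separation 3≤n p = let (x , ¬t) = to triangleless⇔ p in build x ¬t
    where
    others : ∀ {n} → 3 ≤ n → (x : Fin n) → ∃ λ a → ∃ λ b → a ≢ x × b ≢ x × a ≢ b
    others (s≤s (s≤s (s≤s _))) zero          = suc zero , suc (suc zero) , (λ ()) , (λ ()) , λ ()
    others (s≤s (s≤s (s≤s _))) (suc zero)    = zero , suc (suc zero) , (λ ()) , (λ ()) , λ ()
    others (s≤s (s≤s (s≤s _))) (suc (suc _)) = zero , suc zero , (λ ()) , (λ ()) , λ ()
    build : ∀ x → (∀ y z → ¬ T (triangle adj x y z)) → Separation adj adj-sym
    build x ¬t with any? (λ u → ¬? (u Fin.≟ x) ×-dec ¬? (x ~? u))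
    ... | yes (u , u≢x , x≁u) = separation f proper {x} {u} fx fu
      where
      f : Fin n → Label
      f v with v Fin.≟ x | x ~? v
      ... | yes _ | _     = left
      ... | no _  | yes _ = cut
      ... | no _  | no _  = right
      fx : f x ≡ left
      fx with x Fin.≟ x
      ... | yes _ = refl
      ... | no ≢x = contradiction refl ≢x
      fu : f u ≡ right
      fu with u Fin.≟ x | x ~? u
      ... | yes u≡x | _      = contradiction u≡x u≢x
      ... | no _    | yes xu = contradiction xu x≁u
      ... | no _    | no _   = refl
      proper : Proper {adj = adj} f
      proper {v} {w} vw bad with v Fin.≟ x | x ~? v | w Fin.≟ x | x ~? w
      ... | yes _    | _      | yes _    | _      = bad
      ... | yes _    | _      | no _     | yes _  = bad
      ... | yes refl | _      | no _     | no x≁w = x≁w (to adj⇔ vw)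
      ... | no _     | yes _  | yes _    | _      = bad
      ... | no _     | no x≁v | yes refl | _      = x≁v (~-sym (to adj⇔ vw))
      ... | no _     | yes xv | no _     | yes xw = ¬t v w (triangle⁺ xv (to adj⇔ vw) xw)
      ... | no _     | yes _  | no _     | no _   = bad
      ... | no _     | no _   | no _     | yes _  = bad
      ... | no _     | no _   | no _     | no _   = bad
    ... | no star = let (a , b , a≢x , b≢x , a≢b) = others 3≤n x in build-star a b a≢x b≢x a≢b
      where
      adjacent : ∀ {v} → v ≢ x → x ~ v
      adjacent {v} v≢x with x ~? v
      ... | yes xv = xv
      ... | no x≁v = contradiction (v , v≢x , x≁v) star
      -- In the star the centre is the cutset, with the leaf `a` on one side and all other leaves on
      -- the other. Adjacent leaves would form a triangle with `x`.
      build-star : ∀ a b → a ≢ x → b ≢ x → a ≢ b → Separation adj adj-sym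
      build-star a b a≢x b≢x a≢b = separation f proper {a} {b} fa fb
        where
        f : Fin n → Label
        f v with v Fin.≟ x | v Fin.≟ a
        ... | yes _ | _     = cut
        ... | no _  | yes _ = left
        ... | no _  | no _  = right
        fa : f a ≡ left
        fa with a Fin.≟ x | a Fin.≟ a
        ... | yes a≡x | _      = contradiction a≡x a≢x
        ... | no _    | yes _  = refl
        ... | no _    | no a≢a = contradiction refl a≢a
        fb : f b ≡ right
        fb with b Fin.≟ x | b Fin.≟ a
        ... | yes b≡x | _       = contradiction b≡x b≢x
        ... | no _    | yes b≡a = contradiction (sym b≡a) a≢b
        ... | no _    | no _    = refl
        proper : Proper {adj = adj} f
        proper {v} {w} vw bad with v Fin.≟ x | w Fin.≟ x | v Fin.≟ a | w Fin.≟ a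
        ... | yes refl | yes refl | _     | _     = irrefl refl (to adj⇔ vw)
        ... | yes _    | no _     | _     | yes _ = bad
        ... | yes _    | no _     | _     | no _  = bad
        ... | no _     | yes _    | yes _ | _     = bad
        ... | no _     | yes _    | no _  | _     = bad
        ... | no v≢x   | no w≢x   | _     | _     = ¬t v w (triangle⁺ (adjacent v≢x) (to adj⇔ vw) (adjacent w≢x))

  -- The first step of a path from `a` to `b` leads to a vertex `c` other than `a`, and other than
  -- `b` because left and right are never adjacent. That makes three vertices. Connectedness
  -- matters: the empty set separates two isolated vertices.
  small-connected : n < 3 → Connected G → ¬ Separation adj adj-sym
  small-connected n<3 connected (separation f proper {a} {b} fa fb) with connected a b
  ... | ε = case trans (sym fa) fb of λ ()
  ... | _◅_ {j = c} ac _ = pigeonhole a b c n<3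
    (λ { refl → case trans (sym fa) fb of λ () }) (λ { refl → irrefl refl ac })
    (λ { refl → proper (from adj⇔ ac) (subst₂ (λ l m → T (conflict l m)) (sym fa) (sym fb) tt) })
    where
    three : ∀ {k} → Fin k → ¬ suc (suc k) < 3
    three zero    (s≤s (s≤s (s≤s ())))
    three (suc _) (s≤s (s≤s (s≤s ())))
    pigeonhole : ∀ {n} (a b c : Fin n) → n < 3 → a ≢ b → a ≢ c → b ≢ c → ⊥
    pigeonhole zero             zero       c          _ a≢b a≢c b≢c = a≢b refl
    pigeonhole zero             (suc zero) zero       _ a≢b a≢c b≢c = a≢c refl
    pigeonhole zero             (suc zero) (suc zero) _ a≢b a≢c b≢c = b≢c refl
    pigeonhole (suc zero)       zero       zero       _ a≢b a≢c b≢c = b≢c refl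
    pigeonhole (suc zero)       zero       (suc zero) _ a≢b a≢c b≢c = a≢c refl
    pigeonhole (suc zero)       (suc zero) c          _ a≢b a≢c b≢c = a≢b refl
    pigeonhole (suc (suc a)) _ _ n<3 _ _ _ = three a n<3
    pigeonhole zero (suc (suc b)) _ n<3 _ _ _ = three b n<3
    pigeonhole (suc zero) (suc (suc b)) _ n<3 _ _ _ = three b n<3
    pigeonhole zero (suc zero) (suc (suc c)) n<3 _ _ _ = three c n<3
    pigeonhole (suc zero) zero (suc (suc c)) n<3 _ _ _ = three c n<3

-- The decision program

-- An accumulator update, so that the next level is literally what a `fold` over the current one
-- computes.
extend : List (List Label) → List Label → List (List Label)
extend acc w = (left ∷ w) ∷ (right ∷ w) ∷ (cut ∷ w) ∷ acc

strings : ℕ → List (List Label)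
strings zero    = [] ∷ []
strings (suc j) = foldl extend [] (strings j)

length-strings : ∀ j → length (strings j) ≡ 3 ^ j
length-strings zero    = refl
length-strings (suc j) = trans (length-extend (strings j) [])
  (trans (+-identityʳ _) (cong (3 *_) (length-strings j)))
  where
  length-extend : ∀ ws acc → length (foldl extend acc ws) ≡ 3 * length ws + length acc
  length-extend []       acc = refl
  length-extend (w ∷ ws) acc = trans (length-extend ws (extend acc w)) (shift (length ws) (length acc))
    where
    shift : ∀ l a → 3 * l + (3 + a) ≡ 3 * (1 + l) + a
    shift = solve-∀

∈-strings : ∀ {w j} → length w ≡ j → w ∈ strings j
∈-strings {[]}    refl = here refl
∈-strings {l ∷ w} refl = grows l [] (inj₂ (∈-strings {w} refl))
  where
  keeps : ∀ {v ws} acc → v ∈ acc → v ∈ foldl extend acc ws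
  keeps {ws = []}     acc v∈ = v∈
  keeps {ws = w ∷ ws} acc v∈ = keeps {ws = ws} (extend acc w) (there (there (there v∈)))
  new : ∀ l {w acc} → l ∷ w ∈ extend acc w
  new left  = here refl
  new right = there (here refl)
  new cut   = there (there (here refl))
  grows : ∀ l {w ws} acc → l ∷ w ∈ acc ⊎ w ∈ ws → l ∷ w ∈ foldl extend acc ws
  grows l {ws = ws}     acc (inj₁ v∈)         = keeps {ws = ws} acc v∈
  grows l {ws = v ∷ ws} acc (inj₂ (here refl)) = keeps {ws = ws} (extend acc v) (new l)
  grows l {ws = v ∷ ws} acc (inj₂ (there w∈))  = grows l (extend acc v) (inj₂ w∈)

strings-length : ∀ j → All (λ w → length w ≡ j) (strings j)
strings-length zero    = refl ∷ []
strings-length (suc j) = extend-length (strings-length j) []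
  where
  extend-length : ∀ {j ws acc} → All (λ w → length w ≡ j) ws → All (λ w → length w ≡ suc j) acc →
    All (λ w → length w ≡ suc j) (foldl extend acc ws)
  extend-length []       qs = qs
  extend-length (p ∷ ps) qs = extend-length ps (cong suc p ∷ cong suc p ∷ cong suc p ∷ qs)

module _ {n : ℕ} (adj : Matrix n) where

  -- The last dominating string wins. The default is the empty string, which need not dominate;
  -- hence `Found` tests the selected string once more.
  select : List (List Label) → List Label
  select = foldl (λ acc w → Bool.if dominating adj w then w else acc) []

  select-dominating : ∀ {w ws} → w ∈ ws → T (dominating adj w) → T (dominating adj (select ws))
  select-dominating w∈ d = go _ (inj₂ (lose w∈ d))
    where
    go : ∀ ws {acc} → T (dominating adj acc) ⊎ Any (T ∘ dominating adj) ws →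
      T (dominating adj (foldl (λ acc w → Bool.if dominating adj w then w else acc) acc ws))
    go []       (inj₁ d) = d
    go (w ∷ ws) p with dominating adj w in eq
    go (w ∷ ws) p              | true  = go ws (inj₁ (subst T (sym eq) tt))
    go (w ∷ ws) (inj₁ d)         | false = go ws (inj₁ d)
    go (w ∷ ws) (inj₂ (here d))  | false = contradiction (subst T eq d) λ ()
    go (w ∷ ws) (inj₂ (there p)) | false = go ws (inj₂ p)

  select-length : ∀ j → length (select (strings j)) ≤ j
  select-length j = go (All.map ≤-reflexive (strings-length j)) z≤n
    where
    go : ∀ {ws acc} → All (λ w → length w ≤ j) ws → length acc ≤ j →
      length (foldl (λ acc w → Bool.if dominating adj w then w else acc) acc ws) ≤ j
    go [] p = p
    go {w ∷ ws} (q ∷ qs) p with dominating adj w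
    ... | true  = go qs q
    ... | false = go qs p

  Found : ℕ → Set
  Found j = T (dominating adj (select (strings j)))

  found : ∀ {j} → (∃ λ w → length w ≡ j × T (dominating adj w)) → Found j
  found (w , len , d) = select-dominating (∈-strings len) d

  answer : List (List Label) → Bool
  answer ws = foldl (λ acc ls → acc ∨ labelled adj (select ws) ls) false ws

level : Ctx
level = list (list label) ∷ matrixᵗ ∷ []

extendᵗ : Term (list label ∷ list (list label) ∷ level) (list (list label))
extendᵗ = push (push (lab left) (# 0)) (push (push (lab right) (# 0)) (push (push (lab cut) (# 0)) (# 1)))

selectᵗ : Term (list label ∷ list label ∷ level) (list label)
selectᵗ = cond (call dominatingᵗ (# 0 ∷ # 3 ∷ [])) (# 0) (# 1)

failedᵗ : Term (list label ∷ level) bool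
failedᵗ = neg (call dominatingᵗ (# 0 ∷ # 2 ∷ []))

answerᵗ : Term (list label ∷ bool ∷ list label ∷ level) bool
answerᵗ = # 1 or call labelledᵗ (# 2 ∷ # 0 ∷ # 4 ∷ [])

selectᵖ guardᵖ extendᵖ answerᵖ searchᵖ setupᵖ decideᵖ : Prog
selectᵖ = fold hd (const nil) (compile selectᵗ)
guardᵖ  = cons selectᵖ var ⨾ compile failedᵗ
extendᵖ = cons (fold hd (const nil) (compile extendᵗ)) tl
answerᵖ = cons selectᵖ var ⨾ fold (tl ⨾ hd) (const nil) (compile answerᵗ)
-- `nil ∙ nil` encodes `strings 0`, whose only element is the empty string.
searchᵖ = cons (const (nil ∙ nil)) var ⨾ (while guardᵖ loop extendᵖ) ⨾ answerᵖ
-- Each row of the matrix turns the numeral m into its successor, so the result is n.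
setupᵖ  = cons var (fold var (const nil) (cons (tl ⨾ hd) (tl ⨾ hd)))
decideᵖ = setupᵖ ⨾
  if compile trianglelessᵗ
  -- The matrix has a third row exactly if n is at least 3.
  then (if hd ⨾ tl ⨾ tl then const (nil ∙ nil) else const nil)
  else searchᵖ

-- pad k c at n is 2 * k + c at n; the bound for a fold over L elements needs 18.
pad : ℕ → Cost → Cost
pad zero    c = c
pad (suc k) c = one ⊕ pad k c

stringsCost : Cost → Cost → Cost → Cost
stringsCost l i b = l ⊕ (i ⊕ one) ⊕ (pad 9 b ⊕ (one ⊕ one))

selectCost guardCost extendCost iterationCost answerCost searchCost setupCost sizeCost decideCost : Cost
selectCost    = stringsCost one one (cost selectᵗ)
guardCost     = selectCost ⊕ one ⊕ cost failedᵗ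
extendCost    = stringsCost one one (cost extendᵗ) ⊕ one
iterationCost = guardCost ⊕ extendCost
answerCost    = selectCost ⊕ one ⊕ stringsCost (one ⊕ one) one (cost answerᵗ)
searchCost    = one ⊕ one ⊕ ((iterationCost ⊕ each iterationCost) ⊕ answerCost)
setupCost     = one ⊕ foldCost one one (one ⊕ one ⊕ (one ⊕ one))
sizeCost      = one ⊕ (one ⊕ one) ⊕ (one ⊕ one)
decideCost    = setupCost ⊕ (cost trianglelessᵗ ⊕ (sizeCost ⊕ searchCost))

-- Running time of the decision program

scale-suc : ∀ {L s t} → 1 ≤ L → ∀ a b → s ≤ L * a → t ≤ L * b → suc (s + t) ≤ L * suc (a + b)
scale-suc {L} 1≤L a b s≤ t≤ = ≤-trans (+-mono-≤ 1≤L (+-mono-≤ s≤ t≤)) (≤-reflexive (collect L a b))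
  where
  collect : ∀ L a b → L + (L * a + L * b) ≡ L * (1 + (a + b))
  collect = solve-∀

-- Running times of the form L * (c at n), where L is the number of strings.
module Scaled (L n : ℕ) (1≤L : 1 ≤ L) where

  scale : ∀ {p x y t} → p ⊢ x ⇓ y within t → p ⊢ x ⇓ y within L * t
  scale {t = t} = weaken (≤-trans (≤-reflexive (sym (*-identityˡ t))) (*-monoˡ-≤ t 1≤L))

  cons-scaled : ∀ {p q x y z} a b → p ⊢ x ⇓ y within L * (a at n) → q ⊢ x ⇓ z within L * (b at n) →
    cons p q ⊢ x ⇓ y ∙ z within L * ((a ⊕ b) at n)
  cons-scaled a b r r′ = weaken (scale-suc 1≤L (a at n) (b at n) ≤-refl ≤-refl) (cons-within r r′)

  seq-scaled : ∀ {p q x y z} a b → p ⊢ x ⇓ y within L * (a at n) → q ⊢ y ⇓ z within L * (b at n) →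
    p ⨾ q ⊢ x ⇓ z within L * ((a ⊕ b) at n)
  seq-scaled a b r r′ = weaken (scale-suc 1≤L (a at n) (b at n) ≤-refl ≤-refl) (r ⨾-within r′)

  fold-scaled : ∀ {A B : Set} {encA : A → Tree} {encB : B → Tree} {f : B → A → B} {b l i x} c s t ys a →
    length ys ≤ L →
    (∀ y a → b ⊢ encA y ∙ (encB a ∙ x) ⇓ encB (f a y) within c at n) →
    l ⊢ x ⇓ encodeList (map encA ys) within s at n → i ⊢ x ⇓ encB a within t at n →
    fold l i b ⊢ x ⇓ encB (foldl f a ys) within L * (stringsCost s t c at n)
  fold-scaled {encA = encA} {encB} {f} c s t ys a ys≤L step l i =
    weaken (scale-suc 1≤L ((s ⊕ (t ⊕ one)) at n) ((pad 9 c ⊕ (one ⊕ one)) at n)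
        (grow ((s ⊕ (t ⊕ one)) at n)) (scale-suc 1≤L (pad 9 c at n) 3 loop (grow 3)))
      (fold-within encA encB f step ys a l i)
    where
    grow : ∀ m → m ≤ L * m
    grow m = ≤-trans (≤-reflexive (sym (*-identityˡ m))) (*-monoˡ-≤ m 1≤L)
    loop : length ys * (16 + c at n) + 2 ≤ L * (18 + c at n)
    loop = ≤-trans (+-mono-≤ (*-monoˡ-≤ (16 + c at n) ys≤L) (*-monoˡ-≤ 2 1≤L)) (≤-reflexive (collect L (c at n)))
      where
      collect : ∀ L c → L * (16 + c) + L * 2 ≡ L * (18 + c)
      collect = solve-∀

module _ {g p : Prog} (state : ℕ → Tree) (done : ℕ → Bool) (a b : ℕ)
  (guard : ∀ j → g ⊢ state j ⇓ encodeBool (not (done j)) within 3 ^ j * a)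
  (body : ∀ j → p ⊢ state j ⇓ state (suc j) within 3 ^ j * b) where

  -- The loop stops at the first successful level k, and no iteration takes
  -- longer than the last one may.
  while-within : ∀ m j {k₀} → m + j ≡ k₀ → T (done k₀) →
    ∃[ r ] ∃[ k ] r + j ≡ k × T (done k) × (∀ i → j ≤ i → T (done i) → k ≤ i) ×
      (while g loop p ⊢ state j ⇓ state k within suc r * (3 ^ k * suc (a + b)))
  while-within m j m+j done-k₀ with done j in eq | guard j
  ... | true | s , w , s≤ = 0 , j , refl , subst T (sym eq) tt , (λ i j≤i _ → j≤i) , _ , while-false w ,
    (begin
      suc s                   ≤⟨ s≤s s≤ ⟩
      suc (3 ^ j * a)         ≤⟨ +-monoˡ-≤ (3 ^ j * a) (m^n>0 3 j) ⟩
      3 ^ j + 3 ^ j * a       ≡⟨ *-suc (3 ^ j) a ⟨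
      3 ^ j * suc a           ≤⟨ *-monoʳ-≤ (3 ^ j) (s≤s (m≤m+n a b)) ⟩
      3 ^ j * suc (a + b)     ≤⟨ m≤m+n _ _ ⟩
      1 * (3 ^ j * suc (a + b)) ∎)
    where open ≤-Reasoning
  while-within zero    j refl done-k₀ | false | _ = contradiction (subst T eq done-k₀) λ ()
  while-within (suc m) j m+j done-k₀ | false | s , w , s≤ =
    let (r , k , r+j , done-k , minimal , u , w′ , u≤) = while-within m (suc j) (trans (+-suc m j) m+j) done-k₀
        (t , v , t≤) = body j
        j≤k = ≤-trans (m≤n+m j (suc r)) (≤-reflexive (trans (sym (+-suc r j)) r+j))
    in suc r , k , trans (sym (+-suc r j)) r+j , done-k ,
       (λ i j≤i done-i → minimal i (≤∧≢⇒< j≤i λ { refl → contradiction (subst T eq done-i) λ () }) done-i) ,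
       _ , while-true w v w′ ,
       +-mono-≤ (≤-trans (scale-suc (m^n>0 3 j) a b s≤ t≤) (*-monoˡ-≤ (suc (a + b)) (^-monoʳ-≤ 3 j≤k))) u≤

module _ {n : ℕ} (adj : Matrix n) where

  input : Env n (matrixᵗ ∷ [])
  input = adj ∷ []

  state : ℕ → Env n level
  state j = strings j ∷ input

  module _ (j : ℕ) where
    open Scaled (3 ^ j) n (m^n>0 3 j)

    select-within : selectᵖ ⊢ encodeEnv (state j) ⇓ encode {n} (list label) (select adj (strings j))
      within 3 ^ j * (selectCost at n)
    select-within = fold-scaled {encB = encode {n} (list label)} (cost selectᵗ) one one (strings j) []
      (≤-reflexive (length-strings j)) (λ w acc → run selectᵗ (w ∷ acc ∷ state j)) hd-within const-within

    selected-within : cons selectᵖ var ⊢ encodeEnv (state j) ⇓ encodeEnv (select adj (strings j) ∷ state j)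
      within 3 ^ j * ((selectCost ⊕ one) at n)
    selected-within = cons-scaled selectCost one select-within (scale var-within)

    guard-within : guardᵖ ⊢ encodeEnv (state j) ⇓ encodeBool (not (dominating adj (select adj (strings j))))
      within 3 ^ j * (guardCost at n)
    guard-within = seq-scaled (selectCost ⊕ one) (cost failedᵗ) selected-within
      (scale (run failedᵗ (select adj (strings j) ∷ state j)))

    extend-within : extendᵖ ⊢ encodeEnv (state j) ⇓ encodeEnv (state (suc j)) within 3 ^ j * (extendCost at n)
    extend-within = cons-scaled (stringsCost one one (cost extendᵗ)) one
      (fold-scaled {encB = encode {n} (list (list label))} (cost extendᵗ) one one (strings j) []
        (≤-reflexive (length-strings j)) (λ w acc → run extendᵗ (w ∷ acc ∷ state j)) hd-within const-within)
      (scale tl-within)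

    answer-within : answerᵖ ⊢ encodeEnv (state j) ⇓ encodeBool (answer adj (strings j))
      within 3 ^ j * (answerCost at n)
    answer-within = seq-scaled (selectCost ⊕ one) (stringsCost (one ⊕ one) one (cost answerᵗ)) selected-within
      (fold-scaled {encB = encodeBool} (cost answerᵗ) (one ⊕ one) one (strings j) false
        (≤-reflexive (length-strings j))
        (λ ls acc → run answerᵗ (ls ∷ acc ∷ select adj (strings j) ∷ state j))
        (tl-within ⨾-within hd-within) const-within)

  -- Success at level n bounds the number of iterations by n. Each costs at most `3 ^ k` times a
  -- polynomial, so their number goes into the polynomial factor and no geometric sum is needed.
  search-within : Found adj n →
    ∃[ k ] Found adj k × (∀ i → Found adj i → k ≤ i) ×
      (searchᵖ ⊢ encodeEnv input ⇓ encodeBool (answer adj (strings k)) within 3 ^ k * (searchCost at n))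
  search-within found =
    let (r , k , r+0 , found′ , minimal , w) =
          while-within (encodeEnv ∘ state) (λ j → dominating adj (select adj (strings j)))
            (guardCost at n) (extendCost at n) guard-within extend-within n 0 (+-identityʳ n) found
        open Scaled (3 ^ k) n (m^n>0 3 k)
        r≤n = ≤-trans (≤-reflexive (trans (sym (+-identityʳ r)) r+0)) (minimal n z≤n found)
    in k , found′ , (λ i → minimal i z≤n) ,
       seq-scaled (one ⊕ one) ((iterationCost ⊕ each iterationCost) ⊕ answerCost)
         (scale (cons-within const-within var-within))
         (seq-scaled (iterationCost ⊕ each iterationCost) answerCost
           (weaken (iterations r (3 ^ k) (iterationCost at n) r≤n) w)
           (answer-within k))
    where
    iterations : ∀ r L q → r ≤ n → suc r * (L * q) ≤ L * suc (q + (n * (16 + q) + 2))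
    iterations r L q r≤n = begin
      suc r * (L * q)                     ≤⟨ *-monoˡ-≤ (L * q) (s≤s r≤n) ⟩
      suc n * (L * q)                     ≡⟨ swap n L q ⟩
      L * (q + n * q)                     ≤⟨ *-monoʳ-≤ L (m≤n⇒m≤1+n (+-monoʳ-≤ q (≤-trans (*-monoʳ-≤ n (m≤n+m q 16)) (m≤m+n _ 2)))) ⟩
      L * suc (q + (n * (16 + q) + 2))    ∎
      where
      open ≤-Reasoning
      swap : ∀ n L q → (1 + n) * (L * q) ≡ L * (q + n * q)
      swap = solve-∀

  setup-within : setupᵖ ⊢ encode matrixᵗ adj ⇓ encodeEnv input within setupCost at n
  setup-within = cons-within var-within
    (subst₂ (λ l m → fold var (const nil) _ ⊢ encode matrixᵗ adj ⇓ numeral m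
        -- The body `cons (tl ⨾ hd) (tl ⨾ hd)` takes 7 steps.
        within suc (suc (1 + suc (1 + 1)) + suc ((l * (16 + 7) + 2) + 3)))
      (length-tabulate {n = n} id) (trans (count (allFin n) 0) (trans (+-identityʳ _) (length-tabulate {n = n} id)))
      (fold-within row numeral (λ m _ → suc m)
        (λ _ _ → cons-within (tl-within ⨾-within hd-within) (tl-within ⨾-within hd-within)) (allFin n) 0
        (subst (λ rows → var ⊢ encode matrixᵗ adj ⇓ encodeList rows within 1) (sym (map-tabulate id row)) var-within)
        const-within))
    where
    row : Fin n → Tree
    row u = encode (array bool) (adj u)
    count : ∀ (us : List (Fin n)) m → foldl (λ m _ → suc m) m us ≡ length us + m
    count []       m = refl
    count (_ ∷ us) m = trans (count us (suc m)) (+-suc (length us) m)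

-- Correctness and the final time bound

n<size : ∀ {n} (G : Graph (Fin n)) → n < size (encodeGraph G)
n<size {n} G = ≤-trans (s≤s (≤-reflexive (sym (length-tabulate {n = n} _)))) (length<size _)
  where
  length<size : ∀ ts → length ts < size (encodeList ts)
  length<size []       = ≤-refl
  length<size (t ∷ ts) = s≤s (≤-trans (length<size ts) (m≤n+m _ (size t)))

reflects : ∀ {P : Set} b → (T b → P) → (¬ T b → ¬ P) → Reflects P b
reflects true  p _  = ofʸ (p tt)
reflects false _ ¬p = ofⁿ (¬p id)

size-within : ∀ {n} (row : Fin n → Tree) {x} →
  if hd ⨾ tl ⨾ tl then const (nil ∙ nil) else const nil ⊢ encodeList (tabulate row) ∙ x ⇓ encodeBool (3 ≤ᵇ n)
    within sizeCost at n
size-within {0} row = if-false-within 1 (hd-within ⨾-within (_ , tl , ≤-refl) ⨾-within (_ , tl , ≤-refl)) const-within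
size-within {1} row = if-false-within 1 (hd-within ⨾-within tl-within ⨾-within (_ , tl , ≤-refl)) const-within
size-within {2} row = if-false-within 1 (hd-within ⨾-within tl-within ⨾-within tl-within) const-within
size-within {suc (suc (suc n))} row =
  if-true-within 1 (hd-within ⨾-within tl-within ⨾-within tl-within) const-within

module _ {n : ℕ} (G : Graph (Fin n)) where

  private
    A : Matrix n
    A = adj G

  Time : ℕ → Set
  Time t = ∀ k → OddCycleTransversalNumber G k → t ≤ 3 ^ k * (decideCost at n)

  Solved : Set
  Solved = ∃[ b ] ∃[ t ] (decideᵖ ⊢ encodeGraph G ⇓ encodeBool b ⟨ t ⟩) × Reflects (HasIndependentCutset G) b × Time t

  module _ (connected : Connected G) (test : T (triangleless A)) where

    triangleless-reflects : Reflects (HasIndependentCutset G) (3 ≤ᵇ n)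
    triangleless-reflects = reflects (3 ≤ᵇ n)
      (λ 3≤n → separation⇒cutset G (triangleless-separation G (≤ᵇ⇒≤ 3 n 3≤n) test))
      (λ 3≰n cutset → cutset⇒¬¬separation G cutset (small-connected G (≰⇒> (3≰n ∘ ≤⇒≤ᵇ)) connected))

  module _ (test : ¬ T (triangleless A)) where

    hits-found : ∀ {X k} → Hits A (adj-sym G) (λ _ → false) X → ∣ X ∣ ≡ k → Found A k
    hits-found hits X≡k = found A (dominating⁺ A (adj-sym G) (¬triangleless G test) hits (≤-reflexive X≡k))

    -- The whole vertex set hits every triangle. This gives termination before any transversal
    -- number is at hand.
    found-order : Found A n
    found-order = hits-found {⊤} (λ _ _ _ _ _ → left , ∈⊤) (∣⊤∣≡n n)

    found-transversal : ∀ {k} → OddCycleTransversalNumber G k → Found A k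
    found-transversal ((X , transversal , X≡k) , _) = hits-found (transversal-hits G transversal) X≡k

    answer-reflects : ∀ k → Found A k → Reflects (HasIndependentCutset G) (answer A (strings k))
    answer-reflects k found-k = reflects _ sound complete
      where
      ws : List Label
      ws = select A (strings k)
      sound : T (answer A (strings k)) → HasIndependentCutset G
      sound p with foldl-∨⁻ (labelled A ws) (strings k) p
      ... | inj₂ q = let (ls , r) = Any.satisfied q in separation⇒cutset G (labelled⁻ A (adj-sym G) ws ls r)
      complete : ¬ T (answer A (strings k)) → ¬ HasIndependentCutset G
      complete ¬p cutset = cutset⇒¬¬separation G cutset λ s →
        let (ls , len , q) = labelled⁺ A (adj-sym G) ws k found-k (select-length A k) s
        in ¬p (foldl-∨⁺ (labelled A ws) (strings k) (inj₂ (lose (∈-strings len) q)))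

  solve : Connected G → Solved
  solve connected = by-cases (triangleless A) refl (run trianglelessᵗ (input A))
    where
    by-cases : ∀ b → triangleless A ≡ b →
      compile trianglelessᵗ ⊢ encodeEnv (input A) ⇓ encodeBool b within cost trianglelessᵗ at n → Solved
    by-cases true eq r =
      let (t , run , t≤) = setup-within A ⨾-within
            if-true-within (searchCost at n) r (size-within (λ u → encode (array bool) (A u)))
      in (3 ≤ᵇ n) , t , run , triangleless-reflects connected (subst T (sym eq) tt) ,
         λ k _ → ≤-trans t≤ (≤-trans (≤-reflexive (sym (*-identityˡ _))) (*-monoˡ-≤ (decideCost at n) (m^n>0 3 k)))
    by-cases false eq r =
      let test = subst T eq
          (k , found-k , minimal , search) = search-within A (found-order test)
          open Scaled (3 ^ k) n (m^n>0 3 k)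
          (t , run , t≤) = scale {t = setupCost at n} (setup-within A) ⨾-within
            if-false-within (3 ^ k * (sizeCost at n)) (scale {t = cost trianglelessᵗ at n} r) search
      in answer A (strings k) , t , run , answer-reflects test k found-k ,
         λ k′ number → ≤-trans t≤ (≤-trans
           (scale-suc (m^n>0 3 k) (setupCost at n) _ ≤-refl
             (scale-suc (m^n>0 3 k) (cost trianglelessᵗ at n) _ ≤-refl
               (scale-suc (m^n>0 3 k) (sizeCost at n) (searchCost at n) ≤-refl ≤-refl)))
           -- The loop stopped at the first successful level `k`, and level `k′` succeeds thanks to
           -- a minimum transversal; hence k ≤ k′.
           (*-monoˡ-≤ (decideCost at n) (^-monoʳ-≤ 3 (minimal k′ (found-transversal test number)))))

corollary4p8 : ∃[ p ] ∃[ c ] ∃[ d ]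
    (∀ {n : ℕ} (G : Graph (Fin n)) → Connected G →
    ∃[ b ] ∃[ t ]
    ((p ⊢ encodeGraph G ⇓ encodeBool b ⟨ t ⟩)
    × Reflects (HasIndependentCutset G) b
    × (∀ k → OddCycleTransversalNumber G k → t ≤ c * (3 ^ k * size (encodeGraph G) ^ d))))
corollary4p8 = let (c , d , polynomial) = at-polynomial decideCost in
  decideᵖ , c , d , λ {n} G connected →
    let (b , t , runs , correct , time) = solve G connected
        s = size (encodeGraph G)
    in b , t , runs , correct , λ k number → let open ≤-Reasoning in begin
      t                        ≤⟨ time k number ⟩
      3 ^ k * (decideCost at n) ≤⟨ *-monoʳ-≤ (3 ^ k) (polynomial n s (n<size G)) ⟩
      3 ^ k * (c * s ^ d)      ≡⟨ *-assoc (3 ^ k) c (s ^ d) ⟨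
      3 ^ k * c * s ^ d        ≡⟨ cong (_* s ^ d) (*-comm (3 ^ k) c) ⟩
      c * 3 ^ k * s ^ d        ≡⟨ *-assoc c (3 ^ k) (s ^ d) ⟩
      c * (3 ^ k * s ^ d)      ∎
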